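{- Let $n,B_1,B_2$ be positive integers with $n\ge B_1+B_2\ge 2B_1$, let $k\ge3$ be odd with $B_2/k$ a positive integer, and let $f_j=1/j$ for $j\in[n]$. Let $h_1,\dots,h_k:[n]\setminus[B_1]\to[B_2/k]$ and $s_1,\dots,s_k:[n]\setminus[B_1]\to\{ -1,1\}$ be independent, truly (uniformly) random functions. For $i\in[n]\setminus[B_1]$ define $$\tilde f_i=\mathrm{median}_{\ell\in[k]}\left(s_\ell(i)\sum_{j\in[n]\setminus[B_1]}[h_\ell(j)=h_\ell(i)]\,s_\ell(j)f_j\right).$$ Then for every $i\in[n]\setminus[B_1]$, $\mathbb{E}[|\tilde f_i-f_i|]=\Omega(1/B_2)$, with an absolute implied constant.
   Context: $[E]$ denotes the indicator of the event $E$; $[m]=\{1,\dots,m\}$. For odd $k$, the median of $k$ reals is the middle value after sorting. -}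

module Defs where

open import Data.Nat as ℕ using (ℕ; zero; suc; _/_)
open import Data.Fin using (Fin; toℕ)
open import Data.Fin.Properties using (_≟_)
open import Data.Bool using (Bool; true; false; if_then_else_)
open import Data.Product using (_×_; _,_)
open import Data.List using (List; []; _∷_; [_]; map; concatMap; allFin; cartesianProduct; length; foldr)
open import Data.Vec.Functional using () renaming (_∷_ to _∷ᶠ_)
open import Data.Integer using (+_; -[1+_])
open import Data.Rational as ℚ using (ℚ; 0ℚ; 1ℚ; _+_; _*_; -_; ∣_∣)
open import Data.Rational.Properties using (≤-decTotalOrder)
open import Data.List.Sort ≤-decTotalOrder using (sort)
open import Relation.Nullary.Decidable using (does)

Σ : {m : ℕ} → (Fin m → ℚ) → ℚ
Σ {m} g = foldr _+_ 0ℚ (map g (allFin m))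

allFuns : {A : Set} → (m : ℕ) → List A → List (Fin m → A)
allFuns zero    as = [ (λ ()) ]
allFuns (suc m) as = concatMap (λ a → map (λ g → a ∷ᶠ g) (allFuns m as)) as

-- uniform expectation of X over a finite sample space listed by xs
-- (average; the empty case never occurs below)
avg : {A : Set} → List A → (A → ℚ) → ℚ
avg []       X = 0ℚ
avg (x ∷ xs) X = (foldr _+_ 0ℚ (map X (x ∷ xs))) * (+ 1 ℚ./ suc (length xs))

nth : List ℚ → ℕ → ℚ
nth []       _       = 0ℚ
nth (x ∷ xs) zero    = x
nth (x ∷ xs) (suc i) = nth xs i

median : List ℚ → ℚ
median xs = nth (sort xs) (length xs / 2)

sgn : Bool → ℚ
sgn true  = 1ℚ
sgn false = - 1ℚ

-- Domain [n] \ [B₁] is indexed by t : Fin (n ∸ B₁), t ↦ j = B₁ + 1 + toℕ t.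
-- f_j = 1/j
fval : (B₁ : ℕ) → {m : ℕ} → Fin m → ℚ
fval B₁ t = + 1 ℚ./ suc (B₁ ℕ.+ toℕ t)

-- one row ℓ: hash h : dom → [b], sign s : dom → {-1,1}
Row : ℕ → ℕ → Set
Row m b = (Fin m → Fin b) × (Fin m → Bool)

allRows : (m b : ℕ) → List (Row m b)
allRows m b = cartesianProduct (allFuns m (allFin b)) (allFuns m (true ∷ false ∷ []))

-- sample space: k independent rows, i.e. all functions Fin k → Row m b
Outcome : ℕ → ℕ → ℕ → Set
Outcome k m b = Fin k → Row m b

allOutcomes : (k m b : ℕ) → List (Outcome k m b)
allOutcomes k m b = allFuns k (allRows m b)

rowEst : (B₁ : ℕ) → {m b : ℕ} → Row m b → Fin m → ℚ
rowEst B₁ (h , s) i =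
  sgn (s i) * Σ (λ j → if does (h j ≟ h i) then sgn (s j) * fval B₁ j else 0ℚ)

ftilde : (B₁ : ℕ) → {k m b : ℕ} → Outcome k m b → Fin m → ℚ
ftilde B₁ {k} ω i = median (map (λ ℓ → rowEst B₁ (ω ℓ) i) (allFin k))

-- 𝔼 |f̃_i − f_i| with m = n ∸ B₁ and bucket count b = B₂ / k
expErr : (n B₁ k b : ℕ) → Fin (n ℕ.∸ B₁) → ℚ
expErr n B₁ k b i =
  avg (allOutcomes k (n ℕ.∸ B₁) b) (λ ω → ∣ ftilde B₁ ω i ℚ.- fval B₁ i ∣)

{-# OPTIONS --safe #-}

-- Let t = 1/(2B₂), so that f_j ≥ t for the B₂ smallest j of the domain. The error of a single row is
-- s(i) Z with Z = Σ_{j ≠ i} [h(j) = h(i)] s(j) f_j, a sum of lazy signed steps of which at least kb − 1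
-- have size ≥ t. Kleitman's form of the Littlewood–Offord argument bounds P(−t ≤ Z < t) by the
-- probability that a simple lazy walk from 1 has not hit 0 by time kb − 1, which is p = O(1/√k). By the
-- symmetry of s(i) the row exceeds f_i + t with probability at least q = (1 − p)/2. The median exceeds
-- f_i + t as soon as (k + 1)/2 of the k independent rows do. For q = ½ this has probability ½, and a
-- tensorised Cauchy–Schwarz inequality loses only the factor (4q(1 − q))^k = (1 − p²)^k = Ω(1).
module Submission where

open import Defs
open import Algebra.Bundles using (CommutativeRing)
open import Data.Bool using (Bool; true; false; if_then_else_; _∧_)
open import Data.Bool.Properties using (∧-zeroʳ)
open import Data.Fin using (Fin; zero; suc; toℕ)
import Data.Fin.Properties as Fin
import Data.Integer as ℤ
import Data.Integer.Properties as ℤ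
open import Data.List using (List; []; _∷_; _++_; map; concatMap; allFin; cartesianProduct; length; foldr; tabulate; filter)
open import Data.List.Properties
  using (map-tabulate; length-map; length-++; length-tabulate; filter-accept; filter-reject; length-filter)
open import Data.List.Relation.Binary.Permutation.Propositional.Properties using (↭-length; filter-↭)
open import Data.List.Relation.Unary.Linked as Linked using (Linked; []; [-]; _∷_)
open import Data.Nat as ℕ using (ℕ; zero; suc; z≤n; s≤s)
import Data.Nat.DivMod as ℕ
import Data.Nat.Properties as ℕ
open import Data.Nat.Tactic.RingSolver using () renaming (solve-∀ to ℕ-solve-∀)
open import Data.Product using (Σ-syntax; _×_; _,_)
open import Data.Rational as ℚ
open import Data.Rational.Properties
import Data.Rational.Unnormalised as ℚᵘ
import Data.Rational.Unnormalised.Properties as ℚᵘ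
open import Data.List.Sort ≤-decTotalOrder using (sort; sort-↭; sort-↗)
open import Data.Sum using (inj₁; inj₂)
open import Data.Vec.Functional using (updateAt) renaming (_∷_ to _∷ᶠ_)
open import Data.Vec.Functional.Properties using (updateAt-updates; updateAt-minimal)
open import Function using (_∘_; id; const; mk⇔)
open import Relation.Binary.PropositionalEquality
open import Relation.Nullary using (¬_; yes; no; contradiction)
open import Relation.Nullary.Decidable using (does; does-⇔; dec-true; dec-false; dec⇒maybe)
open import Algebra.Properties.Semiring.Exp (CommutativeRing.semiring +-*-commutativeRing) using (_^_; ^-assocʳ)
open import Tactic.RingSolver using (solve-∀)
open import Tactic.RingSolver.Core.AlmostCommutativeRing using (AlmostCommutativeRing; fromCommutativeRing)

-- The median of k independent rows moves only O(1/√k) around the middle quantile of a single row. A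
-- constant probability of missing `f_i` by t is therefore not enough: the threshold f_i + t must
-- itself lie within O(1/√k) of that quantile. This order is available because, on average, about k
-- of the large frequencies fall into the bucket of i, and a sum of k signed steps of size at least
-- t spreads over about √k cells of width 2t. The steps have different sizes and their positions are
-- not on a lattice, so the argument may use only a lower bound on them. Kleitman's exchange does
-- this, and its induction is the recursion of a random walk whose laziness comes from the hash.
-- Everything is rational. The root of k + 1 is replaced by its integer part L, exponentials by two
-- Bernoulli inequalities, and a central limit estimate by the exact median of the fair coin
-- followed by a change of measure. The loss in that last step is (1 - p²)^k with p² of order 1/k,
-- which stays above a fixed power of ½.

private variable
  A B : Set

-- Rational inequalities, naturals and their reciprocals

ℚ-ring : AlmostCommutativeRing _ _
ℚ-ring = fromCommutativeRing +-*-commutativeRing λ x → dec⇒maybe (0ℚ ≟ x)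

+-nonneg : ∀ {p q} → 0ℚ ≤ p → 0ℚ ≤ q → 0ℚ ≤ p + q
+-nonneg = +-mono-≤

*-monoˡ : ∀ {r p q} → 0ℚ ≤ r → p ≤ q → r * p ≤ r * q
*-monoˡ {r} 0≤r = *-monoˡ-≤-nonNeg r {{nonNegative 0≤r}}

*-monoʳ : ∀ {r p q} → 0ℚ ≤ r → p ≤ q → p * r ≤ q * r
*-monoʳ {r} 0≤r = *-monoʳ-≤-nonNeg r {{nonNegative 0≤r}}

*-nonneg : ∀ {p q} → 0ℚ ≤ p → 0ℚ ≤ q → 0ℚ ≤ p * q
*-nonneg {p} {q} 0≤p 0≤q = subst (_≤ p * q) (*-zeroʳ p) (*-monoˡ 0≤p 0≤q)

square-nonneg : ∀ p → 0ℚ ≤ p * p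
square-nonneg p with ≤-total 0ℚ p
... | inj₁ 0≤p = *-nonneg 0≤p 0≤p
... | inj₂ p≤0 = subst (0ℚ ≤_) (neg-square p) (*-nonneg (neg-antimono-≤ p≤0) (neg-antimono-≤ p≤0))
  where
  neg-square : ∀ p → - p * - p ≡ p * p
  neg-square = solve-∀ ℚ-ring

-- The way polynomial inequalities are proved below: the nonnegative slack `d` is written down,
-- often as a square, and the ring solver checks the identity.
≤-from-difference : ∀ {p q} d → 0ℚ ≤ d → q ≡ p + d → p ≤ q
≤-from-difference {p} d 0≤d eq = subst₂ _≤_ (+-identityʳ p) (sym eq) (+-monoʳ-≤ p 0≤d)

0≤q-p : ∀ {p q} → p ≤ q → 0ℚ ≤ q - p
0≤q-p {p} {q} p≤q = subst (_≤ q - p) (+-inverseʳ p) (+-monoˡ-≤ (- p) p≤q)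

toℚᵘ-/ : ∀ i n → toℚᵘ (i / suc n) ℚᵘ.≃ ℚᵘ.mkℚᵘ i n
toℚᵘ-/ i n = toℚᵘ-fromℚᵘ (ℚᵘ.mkℚᵘ i n)

-- Opaque, since unification would otherwise unfold the gcd normalisation of _/_.
opaque
  ι : ℕ → ℚ
  ι n = ℤ.+ n / 1

  ι≡ : ∀ n → ι n ≡ ℤ.+ n / 1
  ι≡ n = refl

  ι-0 : ι 0 ≡ 0ℚ
  ι-0 = refl

  ι-1 : ι 1 ≡ 1ℚ
  ι-1 = refl

  ι-+ : ∀ m n → ι (m ℕ.+ n) ≡ ι m + ι n
  ι-+ m n = toℚᵘ-injective (begin
    toℚᵘ (ι (m ℕ.+ n))           ≈⟨ toℚᵘ-/ (ℤ.+ (m ℕ.+ n)) 0 ⟩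
    ℚᵘ.mkℚᵘ (ℤ.+ (m ℕ.+ n)) 0      ≈⟨ ℚᵘ.*≡* (cong (ℤ._* ℤ.+ 1) (sym (cong₂ ℤ._+_ (ℤ.*-identityʳ (ℤ.+ m)) (ℤ.*-identityʳ (ℤ.+ n))))) ⟩
    ℚᵘ.mkℚᵘ (ℤ.+ m) 0 ℚᵘ.+ ℚᵘ.mkℚᵘ (ℤ.+ n) 0  ≈⟨ ℚᵘ.+-cong (toℚᵘ-/ (ℤ.+ m) 0) (toℚᵘ-/ (ℤ.+ n) 0) ⟨
    toℚᵘ (ι m) ℚᵘ.+ toℚᵘ (ι n)   ≈⟨ toℚᵘ-homo-+ (ι m) (ι n) ⟨
    toℚᵘ (ι m + ι n)             ∎)
    where open ℚᵘ.≃-Reasoning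

  0≤ι : ∀ n → 0ℚ ≤ ι n
  0≤ι n = nonNegative⁻¹ (ι n) {{normalize-nonNeg n 1}}

-- The value 0 at 0 makes `inv-*` hold without side conditions and agrees with the convention that
-- an empty average is 0.
inv : ℕ → ℚ
inv zero    = 0ℚ
inv (suc n) = ℤ.+ 1 / suc n

0≤inv : ∀ n → 0ℚ ≤ inv n
0≤inv zero    = ≤-refl
0≤inv (suc n) = nonNegative⁻¹ (inv (suc n)) {{normalize-nonNeg 1 (suc n)}}

opaque
  unfolding ι

  ι*inv : ∀ n → ι (suc n) * inv (suc n) ≡ 1ℚ
  ι*inv n = toℚᵘ-injective (begin
    toℚᵘ (ι (suc n) * inv (suc n))          ≈⟨ toℚᵘ-homo-* (ι (suc n)) (inv (suc n)) ⟩
    toℚᵘ (ι (suc n)) ℚᵘ.* toℚᵘ (inv (suc n))  ≈⟨ ℚᵘ.*-cong (toℚᵘ-/ (ℤ.+ suc n) 0) (toℚᵘ-/ (ℤ.+ 1) n) ⟩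
    ℚᵘ.mkℚᵘ (ℤ.+ suc n) 0 ℚᵘ.* ℚᵘ.mkℚᵘ (ℤ.+ 1) n  ≈⟨ ℚᵘ.*≡* (ℤ.*-assoc (ℤ.+ suc n) (ℤ.+ 1) (ℤ.+ suc n)) ⟩
    ℚᵘ.mkℚᵘ (ℤ.+ suc n) n                      ≈⟨ ℚᵘ.*≡* (ℤ.*-comm (ℤ.+ suc n) (ℤ.+ 1)) ⟩
    ℚᵘ.1ℚᵘ                                   ∎)
    where open ℚᵘ.≃-Reasoning

ι-suc : ∀ n → ι (suc n) ≡ 1ℚ + ι n
ι-suc n = trans (ι-+ 1 n) (cong (_+ ι n) ι-1)

ι-* : ∀ m n → ι (m ℕ.* n) ≡ ι m * ι n
ι-* zero    n = trans ι-0 (sym (trans (cong (_* ι n) ι-0) (*-zeroˡ (ι n))))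
ι-* (suc m) n = begin
  ι (n ℕ.+ m ℕ.* n)  ≡⟨ ι-+ n (m ℕ.* n) ⟩
  ι n + ι (m ℕ.* n)  ≡⟨ cong (ι n +_) (ι-* m n) ⟩
  ι n + ι m * ι n    ≡⟨ distrib (ι n) (ι m) ⟩
  (1ℚ + ι m) * ι n   ≡⟨ cong (_* ι n) (ι-suc m) ⟨
  ι (suc m) * ι n    ∎
  where
  open ≡-Reasoning
  distrib : ∀ x y → x + y * x ≡ (1ℚ + y) * x
  distrib = solve-∀ ℚ-ring

ι-mono : ∀ {m n} → m ℕ.≤ n → ι m ≤ ι n
ι-mono {m} {n} m≤n = ≤-from-difference (ι (n ℕ.∸ m)) (0≤ι (n ℕ.∸ m))
  (trans (cong ι (sym (ℕ.m+[n∸m]≡n m≤n))) (ι-+ m (n ℕ.∸ m)))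

1≤ι : ∀ n → 1ℚ ≤ ι (suc n)
1≤ι n = subst (_≤ ι (suc n)) ι-1 (ι-mono (ℕ.s≤s ℕ.z≤n))

inverse-unique : ∀ x {y z} → x * y ≡ 1ℚ → x * z ≡ 1ℚ → y ≡ z
inverse-unique x {y} {z} xy xz = begin
  y            ≡⟨ *-identityʳ y ⟨
  y * 1ℚ       ≡⟨ cong (y *_) xz ⟨
  y * (x * z)  ≡⟨ shuffle x y z ⟩
  x * y * z    ≡⟨ cong (_* z) xy ⟩
  1ℚ * z       ≡⟨ *-identityˡ z ⟩
  z            ∎
  where
  open ≡-Reasoning
  shuffle : ∀ x y z → y * (x * z) ≡ x * y * z
  shuffle = solve-∀ ℚ-ring

inv-* : ∀ m n → inv (m ℕ.* n) ≡ inv m * inv n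
inv-* zero    n       = sym (*-zeroˡ (inv n))
inv-* (suc m) zero    = trans (cong inv (ℕ.*-zeroʳ m)) (sym (*-zeroʳ (inv (suc m))))
inv-* (suc m) (suc n) = inverse-unique (ι (suc m ℕ.* suc n)) (ι*inv (n ℕ.+ m ℕ.* suc n)) (begin
  ι (suc m ℕ.* suc n) * (inv (suc m) * inv (suc n))    ≡⟨ cong (_* (inv (suc m) * inv (suc n))) (ι-* (suc m) (suc n)) ⟩
  ι (suc m) * ι (suc n) * (inv (suc m) * inv (suc n))  ≡⟨ shuffle (ι (suc m)) (ι (suc n)) (inv (suc m)) (inv (suc n)) ⟩
  ι (suc m) * inv (suc m) * (ι (suc n) * inv (suc n))  ≡⟨ cong₂ _*_ (ι*inv m) (ι*inv n) ⟩
  1ℚ                                                   ∎)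
  where
  open ≡-Reasoning
  shuffle : ∀ a b c d → a * b * (c * d) ≡ a * c * (b * d)
  shuffle = solve-∀ ℚ-ring

-- Finite averages

-- Unfolds to the same expression as `Σ` on `allFin m` and as the numerator of `avg`, so its lemmas
-- serve both.
sumOver : List A → (A → ℚ) → ℚ
sumOver xs X = foldr _+_ 0ℚ (map X xs)

sumOver-cong : ∀ (xs : List A) {X Y} → (∀ a → X a ≡ Y a) → sumOver xs X ≡ sumOver xs Y
sumOver-cong []       eq = refl
sumOver-cong (x ∷ xs) eq = cong₂ _+_ (eq x) (sumOver-cong xs eq)

sumOver-mono : ∀ (xs : List A) {X Y} → (∀ a → X a ≤ Y a) → sumOver xs X ≤ sumOver xs Y
sumOver-mono []       le = ≤-refl
sumOver-mono (x ∷ xs) le = +-mono-≤ (le x) (sumOver-mono xs le)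

sumOver-+ : ∀ (xs : List A) X Y → sumOver xs (λ a → X a + Y a) ≡ sumOver xs X + sumOver xs Y
sumOver-+ []       X Y = refl
sumOver-+ (x ∷ xs) X Y = trans (cong (X x + Y x +_) (sumOver-+ xs X Y)) (shuffle (X x) (Y x) _ _)
  where
  shuffle : ∀ a b c d → a + b + (c + d) ≡ a + c + (b + d)
  shuffle = solve-∀ ℚ-ring

sumOver-* : ∀ (xs : List A) c X → sumOver xs (λ a → c * X a) ≡ c * sumOver xs X
sumOver-* []       c X = sym (*-zeroʳ c)
sumOver-* (x ∷ xs) c X = trans (cong (c * X x +_) (sumOver-* xs c X)) (sym (*-distribˡ-+ c (X x) _))

sumOver-const : ∀ (xs : List A) c → sumOver xs (λ _ → c) ≡ ι (length xs) * c
sumOver-const []       c = sym (trans (cong (_* c) ι-0) (*-zeroˡ c))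
sumOver-const (x ∷ xs) c = begin
  c + sumOver xs (λ _ → c)    ≡⟨ cong (c +_) (sumOver-const xs c) ⟩
  c + ι (length xs) * c       ≡⟨ distrib c (ι (length xs)) ⟩
  (1ℚ + ι (length xs)) * c    ≡⟨ cong (_* c) (ι-suc (length xs)) ⟨
  ι (suc (length xs)) * c     ∎
  where
  open ≡-Reasoning
  distrib : ∀ x y → x + y * x ≡ (1ℚ + y) * x
  distrib = solve-∀ ℚ-ring

sumOver-++ : ∀ (xs ys : List A) X → sumOver (xs ++ ys) X ≡ sumOver xs X + sumOver ys X
sumOver-++ []       ys X = sym (+-identityˡ _)
sumOver-++ (x ∷ xs) ys X = trans (cong (X x +_) (sumOver-++ xs ys X)) (sym (+-assoc (X x) _ _))

sumOver-map : ∀ (f : A → B) xs X → sumOver (map f xs) X ≡ sumOver xs (X ∘ f)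
sumOver-map f []       X = refl
sumOver-map f (x ∷ xs) X = cong (X (f x) +_) (sumOver-map f xs X)

sumOver-swap : ∀ (xs : List A) (ys : List B) (X : A → B → ℚ) →
  sumOver xs (λ a → sumOver ys (X a)) ≡ sumOver ys (λ b → sumOver xs (λ a → X a b))
sumOver-swap []       ys X = sym (trans (sumOver-const ys 0ℚ) (*-zeroʳ (ι (length ys))))
sumOver-swap (x ∷ xs) ys X = trans (cong (sumOver ys (X x) +_) (sumOver-swap xs ys X))
  (sym (sumOver-+ ys (X x) (λ b → sumOver xs (λ a → X a b))))

sumOver-product : ∀ (xs : List A) (ys : List B) X →
  sumOver (cartesianProduct xs ys) X ≡ sumOver xs (λ a → sumOver ys (λ b → X (a , b)))
sumOver-product []       ys X = refl
sumOver-product (x ∷ xs) ys X = trans (sumOver-++ (map (x ,_) ys) _ X)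
  (cong₂ _+_ (sumOver-map (x ,_) ys X) (sumOver-product xs ys X))

sumOver-concatMap : ∀ (f : A → List B) xs X →
  sumOver (concatMap f xs) X ≡ sumOver xs (λ a → sumOver (f a) X)
sumOver-concatMap f []       X = refl
sumOver-concatMap f (x ∷ xs) X = trans (sumOver-++ (f x) _ X) (cong (sumOver (f x) X +_) (sumOver-concatMap f xs X))

length-cartesianProduct : ∀ (xs : List A) (ys : List B) →
  length (cartesianProduct xs ys) ≡ length xs ℕ.* length ys
length-cartesianProduct []       ys = refl
length-cartesianProduct (x ∷ xs) ys = trans (length-++ (map (x ,_) ys))
  (cong₂ ℕ._+_ (length-map (x ,_) ys) (length-cartesianProduct xs ys))

length-concatMap : ∀ (f : A → List B) n → (∀ a → length (f a) ≡ n) → ∀ xs →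
  length (concatMap f xs) ≡ length xs ℕ.* n
length-concatMap f n eq []       = refl
length-concatMap f n eq (x ∷ xs) = trans (length-++ (f x)) (cong₂ ℕ._+_ (eq x) (length-concatMap f n eq xs))

opaque
  𝔼 : List A → (A → ℚ) → ℚ
  𝔼 = avg

  𝔼≡avg : ∀ (xs : List A) X → 𝔼 xs X ≡ avg xs X
  𝔼≡avg xs X = refl

  -- One formula for both clauses of `avg`; all later facts about expectations go through it.
  𝔼≡ : ∀ (xs : List A) X → 𝔼 xs X ≡ inv (length xs) * sumOver xs X
  𝔼≡ []       X = refl
  𝔼≡ (x ∷ xs) X = *-comm (sumOver (x ∷ xs) X) _

𝔼-cong : ∀ (xs : List A) {X Y} → (∀ a → X a ≡ Y a) → 𝔼 xs X ≡ 𝔼 xs Y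
𝔼-cong xs eq = trans (𝔼≡ xs _) (trans (cong (inv (length xs) *_) (sumOver-cong xs eq)) (sym (𝔼≡ xs _)))

𝔼-mono : ∀ (xs : List A) {X Y} → (∀ a → X a ≤ Y a) → 𝔼 xs X ≤ 𝔼 xs Y
𝔼-mono xs le = subst₂ _≤_ (sym (𝔼≡ xs _)) (sym (𝔼≡ xs _)) (*-monoˡ (0≤inv (length xs)) (sumOver-mono xs le))

𝔼-+ : ∀ (xs : List A) X Y → 𝔼 xs (λ a → X a + Y a) ≡ 𝔼 xs X + 𝔼 xs Y
𝔼-+ xs X Y = begin
  𝔼 xs (λ a → X a + Y a)       ≡⟨ 𝔼≡ xs _ ⟩
  r * sumOver xs (λ a → X a + Y a)  ≡⟨ cong (r *_) (sumOver-+ xs X Y) ⟩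
  r * (sumOver xs X + sumOver xs Y) ≡⟨ *-distribˡ-+ r _ _ ⟩
  r * sumOver xs X + r * sumOver xs Y ≡⟨ cong₂ _+_ (𝔼≡ xs X) (𝔼≡ xs Y) ⟨
  𝔼 xs X + 𝔼 xs Y            ∎
  where
  open ≡-Reasoning
  r = inv (length xs)

𝔼-* : ∀ (xs : List A) c X → 𝔼 xs (λ a → c * X a) ≡ c * 𝔼 xs X
𝔼-* xs c X = begin
  𝔼 xs (λ a → c * X a)          ≡⟨ 𝔼≡ xs _ ⟩
  r * sumOver xs (λ a → c * X a)  ≡⟨ cong (r *_) (sumOver-* xs c X) ⟩
  r * (c * sumOver xs X)          ≡⟨ shuffle r c _ ⟩
  c * (r * sumOver xs X)          ≡⟨ cong (c *_) (𝔼≡ xs X) ⟨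
  c * 𝔼 xs X                    ∎
  where
  open ≡-Reasoning
  r = inv (length xs)
  shuffle : ∀ a b c → a * (b * c) ≡ b * (a * c)
  shuffle = solve-∀ ℚ-ring

𝔼-swap : ∀ (xs : List A) (ys : List B) (X : A → B → ℚ) →
  𝔼 xs (λ a → 𝔼 ys (X a)) ≡ 𝔼 ys (λ b → 𝔼 xs (λ a → X a b))
𝔼-swap xs ys X = begin
  𝔼 xs (λ a → 𝔼 ys (X a))                        ≡⟨ 𝔼-cong xs (λ a → 𝔼≡ ys (X a)) ⟩
  𝔼 xs (λ a → s * sumOver ys (X a))                ≡⟨ 𝔼-* xs s _ ⟩
  s * 𝔼 xs (λ a → sumOver ys (X a))                ≡⟨ cong (s *_) (𝔼≡ xs _) ⟩
  s * (r * sumOver xs (λ a → sumOver ys (X a)))      ≡⟨ cong (λ z → s * (r * z)) (sumOver-swap xs ys X) ⟩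
  s * (r * sumOver ys (λ b → sumOver xs (λ a → X a b))) ≡⟨ cong (s *_) (sumOver-* ys r _) ⟨
  s * sumOver ys (λ b → r * sumOver xs (λ a → X a b)) ≡⟨ 𝔼≡ ys _ ⟨
  𝔼 ys (λ b → r * sumOver xs (λ a → X a b))        ≡⟨ 𝔼-cong ys (λ b → 𝔼≡ xs (λ a → X a b)) ⟨
  𝔼 ys (λ b → 𝔼 xs (λ a → X a b))                ∎
  where
  open ≡-Reasoning
  r = inv (length xs)
  s = inv (length ys)

𝔼-product : ∀ (xs : List A) (ys : List B) X →
  𝔼 (cartesianProduct xs ys) X ≡ 𝔼 xs (λ a → 𝔼 ys (λ b → X (a , b)))
𝔼-product xs ys X = begin
  𝔼 (cartesianProduct xs ys) X  ≡⟨ 𝔼≡ (cartesianProduct xs ys) X ⟩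
  inv (length (cartesianProduct xs ys)) * sumOver (cartesianProduct xs ys) X
    ≡⟨ cong₂ _*_ (trans (cong inv (length-cartesianProduct xs ys)) (inv-* (length xs) (length ys))) (sumOver-product xs ys X) ⟩
  r * s * sumOver xs (λ a → sumOver ys (λ b → X (a , b)))    ≡⟨ *-assoc r s _ ⟩
  r * (s * sumOver xs (λ a → sumOver ys (λ b → X (a , b))))  ≡⟨ cong (r *_) (sumOver-* xs s _) ⟨
  r * sumOver xs (λ a → s * sumOver ys (λ b → X (a , b)))    ≡⟨ cong (r *_) (sumOver-cong xs (λ a → 𝔼≡ ys _)) ⟨
  r * sumOver xs (λ a → 𝔼 ys (λ b → X (a , b)))            ≡⟨ 𝔼≡ xs _ ⟨
  𝔼 xs (λ a → 𝔼 ys (λ b → X (a , b)))                    ∎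
  where
  open ≡-Reasoning
  r = inv (length xs)
  s = inv (length ys)

𝔼-allFuns-suc : ∀ m (xs : List A) X →
  𝔼 (allFuns (suc m) xs) X ≡ 𝔼 xs (λ a → 𝔼 (allFuns m xs) (λ g → X (a ∷ᶠ g)))
𝔼-allFuns-suc m xs X = begin
  𝔼 (allFuns (suc m) xs) X  ≡⟨ 𝔼≡ (allFuns (suc m) xs) X ⟩
  inv (length (allFuns (suc m) xs)) * sumOver (allFuns (suc m) xs) X
    ≡⟨ cong₂ _*_ (trans (cong inv (length-concatMap cons _ (λ a → length-map (a ∷ᶠ_) gs) xs)) (inv-* (length xs) (length gs)))
                 (trans (sumOver-concatMap cons xs X) (sumOver-cong xs λ a → sumOver-map (a ∷ᶠ_) gs X)) ⟩
  r * s * sumOver xs (λ a → sumOver gs (λ g → X (a ∷ᶠ g)))    ≡⟨ *-assoc r s _ ⟩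
  r * (s * sumOver xs (λ a → sumOver gs (λ g → X (a ∷ᶠ g))))  ≡⟨ cong (r *_) (sumOver-* xs s _) ⟨
  r * sumOver xs (λ a → s * sumOver gs (λ g → X (a ∷ᶠ g)))    ≡⟨ cong (r *_) (sumOver-cong xs (λ a → 𝔼≡ gs _)) ⟨
  r * sumOver xs (λ a → 𝔼 gs (λ g → X (a ∷ᶠ g)))            ≡⟨ 𝔼≡ xs _ ⟨
  𝔼 xs (λ a → 𝔼 gs (λ g → X (a ∷ᶠ g)))                    ∎
  where
  open ≡-Reasoning
  gs = allFuns m xs
  cons = λ a → map (a ∷ᶠ_) gs
  r = inv (length xs)
  s = inv (length gs)

-- This amounts to the list being nonempty, since an empty average is 0, but in a form that iterated
-- averages carry over to products and function spaces.
record IsProb (xs : List A) : Set where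
  constructor isProb
  field total : 𝔼 xs (λ _ → 1ℚ) ≡ 1ℚ

open IsProb

nonempty⇒IsProb : ∀ (x : A) xs → IsProb (x ∷ xs)
nonempty⇒IsProb x xs = isProb (begin
  𝔼 (x ∷ xs) (λ _ → 1ℚ)  ≡⟨ 𝔼≡ (x ∷ xs) (λ _ → 1ℚ) ⟩
  r * sumOver (x ∷ xs) (λ _ → 1ℚ)  ≡⟨ cong (r *_) (sumOver-const (x ∷ xs) 1ℚ) ⟩
  r * (ι (suc (length xs)) * 1ℚ)  ≡⟨ shuffle r (ι (suc (length xs))) ⟩
  ι (suc (length xs)) * r  ≡⟨ ι*inv (length xs) ⟩
  1ℚ                       ∎)
  where
  open ≡-Reasoning
  r = inv (suc (length xs))
  shuffle : ∀ a b → a * (b * 1ℚ) ≡ b * a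
  shuffle = solve-∀ ℚ-ring

𝔼-const : ∀ (xs : List A) → IsProb xs → ∀ c → 𝔼 xs (λ _ → c) ≡ c
𝔼-const xs prob c = begin
  𝔼 xs (λ _ → c)       ≡⟨ 𝔼-cong xs (λ _ → *-identityʳ c) ⟨
  𝔼 xs (λ _ → c * 1ℚ)  ≡⟨ 𝔼-* xs c _ ⟩
  c * 𝔼 xs (λ _ → 1ℚ)  ≡⟨ cong (c *_) (total prob) ⟩
  c * 1ℚ                 ≡⟨ *-identityʳ c ⟩
  c                      ∎
  where open ≡-Reasoning

IsProb-allFuns : ∀ m (xs : List A) → IsProb xs → IsProb (allFuns m xs)
IsProb-allFuns zero    xs prob = nonempty⇒IsProb (λ ()) []
IsProb-allFuns (suc m) xs prob = isProb (trans (𝔼-allFuns-suc m xs (λ _ → 1ℚ))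
  (trans (𝔼-cong xs λ _ → total (IsProb-allFuns m xs prob)) (total prob)))

IsProb-product : ∀ (xs : List A) (ys : List B) → IsProb xs → IsProb ys → IsProb (cartesianProduct xs ys)
IsProb-product xs ys p q = isProb (trans (𝔼-product xs ys (λ _ → 1ℚ)) (trans (𝔼-cong xs λ _ → total q) (total p)))

-- Replacing one coordinate of a uniform function by a fresh uniform value does not change its law.
𝔼-resample : ∀ m (xs : List A) → IsProb xs → ∀ (i : Fin m) F →
  (∀ {g g′} → (∀ j → g j ≡ g′ j) → F g ≡ F g′) →
  𝔼 (allFuns m xs) F ≡ 𝔼 (allFuns m xs) (λ g → 𝔼 xs (λ a → F (updateAt g i (const a))))
𝔼-resample (suc m) xs prob zero F ext = begin
  𝔼 (allFuns (suc m) xs) F                                   ≡⟨ 𝔼-allFuns-suc m xs F ⟩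
  𝔼 xs (λ a → 𝔼 gs (λ g → F (a ∷ᶠ g)))                     ≡⟨ 𝔼-swap xs gs _ ⟩
  𝔼 gs (λ g → 𝔼 xs (λ a → F (a ∷ᶠ g)))                     ≡⟨ 𝔼-const xs prob _ ⟨
  𝔼 xs (λ _ → 𝔼 gs (λ g → 𝔼 xs (λ a → F (a ∷ᶠ g))))
    -- The averaged value `c` is a dummy old value at the coordinate. Overwriting it gives a
    -- function that agrees with `a ∷ᶠ g` only pointwise, hence the hypothesis `ext`.
    ≡⟨ 𝔼-cong xs (λ c → 𝔼-cong gs λ g → 𝔼-cong xs λ a → ext λ { zero → refl ; (suc j) → refl }) ⟩
  𝔼 xs (λ c → 𝔼 gs (λ g → 𝔼 xs (λ a → F (updateAt (c ∷ᶠ g) zero (const a)))))  ≡⟨ 𝔼-allFuns-suc m xs _ ⟨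
  𝔼 (allFuns (suc m) xs) (λ g → 𝔼 xs (λ a → F (updateAt g zero (const a))))      ∎
  where
  open ≡-Reasoning
  gs = allFuns m xs
𝔼-resample (suc m) xs prob (suc i) F ext = begin
  𝔼 (allFuns (suc m) xs) F                                   ≡⟨ 𝔼-allFuns-suc m xs F ⟩
  𝔼 xs (λ c → 𝔼 gs (λ g → F (c ∷ᶠ g)))
    ≡⟨ 𝔼-cong xs (λ c → 𝔼-resample m xs prob i (λ g → F (c ∷ᶠ g)) (λ eq → ext λ { zero → refl ; (suc j) → eq j })) ⟩
  𝔼 xs (λ c → 𝔼 gs (λ g → 𝔼 xs (λ a → F (c ∷ᶠ updateAt g i (const a)))))
    ≡⟨ 𝔼-cong xs (λ c → 𝔼-cong gs λ g → 𝔼-cong xs λ a → ext λ { zero → refl ; (suc j) → refl }) ⟩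
  𝔼 xs (λ c → 𝔼 gs (λ g → 𝔼 xs (λ a → F (updateAt (c ∷ᶠ g) (suc i) (const a)))))  ≡⟨ 𝔼-allFuns-suc m xs _ ⟨
  𝔼 (allFuns (suc m) xs) (λ g → 𝔼 xs (λ a → F (updateAt g (suc i) (const a))))      ∎
  where
  open ≡-Reasoning
  gs = allFuns m xs

𝔼-≤ : ∀ (xs : List A) → IsProb xs → ∀ {X c} → (∀ a → X a ≤ c) → 𝔼 xs X ≤ c
𝔼-≤ xs prob le = ≤-trans (𝔼-mono xs le) (≤-reflexive (𝔼-const xs prob _))

bools : List Bool
bools = true ∷ false ∷ []

IsProb-allFin : ∀ {b} → Fin b → IsProb (allFin b)
IsProb-allFin {suc b} _ = nonempty⇒IsProb zero (tabulate suc)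

IsProb-bools : IsProb bools
IsProb-bools = nonempty⇒IsProb true (false ∷ [])

𝔼-bools : ∀ X → 𝔼 bools X ≡ ½ * (X true + X false)
𝔼-bools X = trans (𝔼≡avg bools X) (rearrange (X true) (X false))
  where
  rearrange : ∀ p q → (p + (q + 0ℚ)) * ½ ≡ ½ * (p + q)
  rearrange = solve-∀ ℚ-ring

Σ-suc : ∀ {m} (g : Fin (suc m) → ℚ) → Σ g ≡ g zero + Σ (g ∘ suc)
Σ-suc g = cong (λ xs → g zero + foldr _+_ 0ℚ xs) (trans (map-tabulate suc g) (sym (map-tabulate id (g ∘ suc))))

Σ-cong : ∀ {m} {f g : Fin m → ℚ} → (∀ j → f j ≡ g j) → Σ f ≡ Σ g
Σ-cong {m} = sumOver-cong (allFin m)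

Σ-zero : ∀ m → Σ {m} (λ _ → 0ℚ) ≡ 0ℚ
Σ-zero m = trans (sumOver-const (allFin m) 0ℚ) (*-zeroʳ (ι (length (allFin m))))

Σ-single : ∀ {m} (i : Fin m) p → Σ (λ j → if does (j Fin.≟ i) then p else 0ℚ) ≡ p
Σ-single {suc m} zero    p = trans (Σ-suc (λ j → if does (j Fin.≟ zero {m}) then p else 0ℚ))
  (trans (cong (p +_) (Σ-zero m)) (+-identityʳ p))
Σ-single {suc m} (suc i) p = trans (Σ-suc (λ j → if does (j Fin.≟ suc i) then p else 0ℚ))
  (trans (+-identityˡ (Σ (λ j → if does (j Fin.≟ i) then p else 0ℚ))) (Σ-single i p))

-- The source of the laziness of the walk: a coordinate takes part exactly when its uniform hash
-- equals `β`. Writing the integrand as q plus (p - q) times a point mass leaves a sum with a single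
-- term.
𝔼-single : ∀ {b} (β : Fin b) p q →
  𝔼 (allFin b) (λ a → if does (a Fin.≟ β) then p else q) ≡ inv b * p + (1ℚ - inv b) * q
𝔼-single {suc b} β p q = begin
  𝔼 (allFin (suc b)) (λ a → if does (a Fin.≟ β) then p else q)
    ≡⟨ 𝔼-cong (allFin (suc b)) split ⟩
  𝔼 (allFin (suc b)) (λ a → δ a + q)
    ≡⟨ 𝔼-+ (allFin (suc b)) δ (λ _ → q) ⟩
  𝔼 (allFin (suc b)) δ + 𝔼 (allFin (suc b)) (λ _ → q)
    ≡⟨ cong₂ _+_ (𝔼≡ (allFin (suc b)) δ) (𝔼-const (allFin (suc b)) (IsProb-allFin β) q) ⟩
  inv (length (allFin (suc b))) * Σ δ + q
    ≡⟨ cong₂ (λ l z → inv l * z + q) (length-tabulate {n = suc b} id) (Σ-single β (p - q)) ⟩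
  inv (suc b) * (p - q) + q
    ≡⟨ rearrange (inv (suc b)) p q ⟩
  inv (suc b) * p + (1ℚ - inv (suc b)) * q ∎
  where
  open ≡-Reasoning
  δ : Fin (suc b) → ℚ
  δ a = if does (a Fin.≟ β) then p - q else 0ℚ
  p-q+q : ∀ p q → p ≡ p - q + q
  p-q+q = solve-∀ ℚ-ring
  split : ∀ a → (if does (a Fin.≟ β) then p else q) ≡ δ a + q
  split a with does (a Fin.≟ β)
  ... | true  = p-q+q p q
  ... | false = sym (+-identityˡ q)
  rearrange : ∀ r p q → r * (p - q) + q ≡ r * p + (1ℚ - r) * q
  rearrange = solve-∀ ℚ-ring

-- Concentration of lazy signed sums

indicator : Bool → ℚ
indicator true  = 1ℚ
indicator false = 0ℚ

0≤indicator : ∀ c → 0ℚ ≤ indicator c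
0≤indicator true  = ≤ᵇ⇒≤ _
0≤indicator false = ≤-refl

indicator≤1 : ∀ c → indicator c ≤ 1ℚ
indicator≤1 true  = ≤-refl
indicator≤1 false = ≤ᵇ⇒≤ _

Gap : ℚ → ℚ → ℚ → Set
Gap d x y = x + d ≤ y

opaque
  -- The interval [x, x + d) is half-open so that left endpoints exactly `d` apart, as `Gap`
  -- permits, still give disjoint cells.
  cell : ℚ → ℚ → ℚ → ℚ
  cell d x y = indicator (does (x ≤? y) ∧ does (y <? x + d))

  cell≤1 : ∀ d x y → cell d x y ≤ 1ℚ
  cell≤1 d x y = indicator≤1 (does (x ≤? y) ∧ does (y <? x + d))

  0≤cell : ∀ d x y → 0ℚ ≤ cell d x y
  0≤cell d x y = 0≤indicator (does (x ≤? y) ∧ does (y <? x + d))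

  cell-inside : ∀ d x y → x ≤ y → y < x + d → cell d x y ≡ 1ℚ
  cell-inside d x y x≤y y<x+d = cong₂ (λ p q → indicator (p ∧ q)) (dec-true (x ≤? y) x≤y) (dec-true (y <? x + d) y<x+d)

  cell-below : ∀ d x y → y < x → cell d x y ≡ 0ℚ
  cell-below d x y y<x = cong (λ p → indicator (p ∧ does (y <? x + d)))
    (dec-false (x ≤? y) (λ x≤y → <-irrefl refl (<-≤-trans y<x x≤y)))

  cell-above : ∀ d x y → ¬ (y < x + d) → cell d x y ≡ 0ℚ
  cell-above d x y y≮x+d = cong indicator (trans (cong (does (x ≤? y) ∧_) (dec-false (y <? x + d) y≮x+d)) (∧-zeroʳ (does (x ≤? y))))

  cell-shift : ∀ d x y a → cell d x (y + a) ≡ cell d (x - a) y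
  cell-shift d x y a = cong₂ (λ p q → indicator (p ∧ q))
    (does-⇔ (mk⇔ (λ le → subst (x - a ≤_) (cancel y a) (+-monoˡ-≤ (- a) le))
                 (λ le → subst (_≤ y + a) (cancel′ x a) (+-monoˡ-≤ a le)))
            (x ≤? y + a) (x - a ≤? y))
    (does-⇔ (mk⇔ (λ lt → subst₂ _<_ (cancel y a) (swap x d a) (+-monoˡ-< (- a) lt))
                 (λ lt → subst (y + a <_) (swap′ x d a) (+-monoˡ-< a lt)))
            (y + a <? x + d) (y <? x - a + d))
    where
    cancel : ∀ y a → y + a - a ≡ y
    cancel = solve-∀ ℚ-ring
    cancel′ : ∀ y a → y - a + a ≡ y
    cancel′ = solve-∀ ℚ-ring
    swap : ∀ x d a → x + d - a ≡ x - a + d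
    swap = solve-∀ ℚ-ring
    swap′ : ∀ x d a → x - a + d + a ≡ x + d
    swap′ = solve-∀ ℚ-ring

opaque
  cells : ℚ → List ℚ → ℚ → ℚ
  cells d xs y = sumOver xs (λ x → cell d x y)

  cells-[] : ∀ d y → cells d [] y ≡ 0ℚ
  cells-[] d y = refl

  cells-∷ : ∀ d x xs y → cells d (x ∷ xs) y ≡ cell d x y + cells d xs y
  cells-∷ d x xs y = refl

  cells-shift : ∀ d xs y a → cells d xs (y + a) ≡ cells d (map (_- a) xs) y
  cells-shift d xs y a = trans (sumOver-cong xs (λ x → cell-shift d x y a))
    (sym (sumOver-map (_- a) xs (λ x → cell d x y)))

module _ {d : ℚ} (0≤d : 0ℚ ≤ d) where

  cells-below : ∀ {x xs y} → Linked (Gap d) (x ∷ xs) → y < x + d → cells d xs y ≡ 0ℚ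
  cells-below {y = y} [-] y<x+d = cells-[] d y
  cells-below {x} {x′ ∷ xs} {y} (x+d≤x′ ∷ gaps) y<x+d = begin
    cells d (x′ ∷ xs) y         ≡⟨ cells-∷ d x′ xs y ⟩
    cell d x′ y + cells d xs y  ≡⟨ cong₂ _+_ (cell-below d x′ y y<x′) (cells-below gaps (<-≤-trans y<x′ x′≤x′+d)) ⟩
    0ℚ                          ∎
    where
    open ≡-Reasoning
    y<x′ : y < x′
    y<x′ = <-≤-trans y<x+d x+d≤x′
    x′≤x′+d : x′ ≤ x′ + d
    x′≤x′+d = ≤-from-difference d 0≤d refl

  -- The cells are disjoint: a point below the end of the first cell misses all later ones, and any
  -- other point misses the first.
  cells≤1 : ∀ {xs} → Linked (Gap d) xs → ∀ y → cells d xs y ≤ 1ℚ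
  cells≤1 {[]}     gaps y = subst (_≤ 1ℚ) (sym (cells-[] d y)) (indicator≤1 false)
  cells≤1 {x ∷ xs} gaps y with y <? x + d
  ... | yes y<x+d = subst (_≤ 1ℚ) (sym only-first) (cell≤1 d x y)
    where
    only-first : cells d (x ∷ xs) y ≡ cell d x y
    only-first = trans (cells-∷ d x xs y) (trans (cong (cell d x y +_) (cells-below gaps y<x+d)) (+-identityʳ (cell d x y)))
  ... | no  y≮x+d = subst (_≤ 1ℚ) (sym not-first) (cells≤1 (Linked.tail gaps) y)
    where
    not-first : cells d (x ∷ xs) y ≡ cells d xs y
    not-first = trans (cells-∷ d x xs y) (trans (cong (_+ cells d xs y) (cell-above d x y y≮x+d)) (+-identityˡ (cells d xs y)))

opaque
  reaches : ℚ → ℚ → Bool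
  reaches t x = does (t ≤? x)

  reaches-true : ∀ {t x} → t ≤ x → reaches t x ≡ true
  reaches-true {t} {x} = dec-true (t ≤? x)

  reaches-false : ∀ {t x} → ¬ (t ≤ x) → reaches t x ≡ false
  reaches-false {t} {x} = dec-false (t ≤? x)

-- The probability that a walk on ℕ started at r, which at each time moves with probability p
-- (up or down equally likely), has not hit 0 by time N.
survival : ℚ → ℕ → ℕ → ℚ
survival p N       zero    = 0ℚ
survival p zero    (suc r) = 1ℚ
survival p (suc N) (suc r) =
  p * (½ * (survival p N (suc (suc r)) + survival p N r)) + (1ℚ - p) * survival p N (suc r)

-- The clock of the walk: only coordinates of weight at least `t` advance it.
countAbove : ∀ {m} → ℚ → (Fin m → ℚ) → ℕ
countAbove {zero}  t w = 0
countAbove {suc m} t w = (if reaches t (w zero) then suc else id) (countAbove t (w ∘ suc))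

opaque
  -- The bucket is a separate argument, not `h i`, so that it stays fixed while all of `h` is
  -- averaged in `concentration`.
  bucketSum : ∀ {m b} → Fin b → (Fin m → ℚ) → (Fin m → Fin b) → (Fin m → Bool) → ℚ
  bucketSum β w h s = Σ (λ j → if does (h j Fin.≟ β) then sgn (s j) * w j else 0ℚ)

  bucketSum≡ : ∀ {m b} (β : Fin b) (w : Fin m → ℚ) h s →
    bucketSum β w h s ≡ Σ (λ j → if does (h j Fin.≟ β) then sgn (s j) * w j else 0ℚ)
  bucketSum≡ β w h s = refl

  bucketSum-∷ : ∀ {m b} (β : Fin b) (w : Fin (suc m) → ℚ) a h c s →
    bucketSum β w (a ∷ᶠ h) (c ∷ᶠ s) ≡ (if does (a Fin.≟ β) then sgn c * w zero else 0ℚ) + bucketSum β (w ∘ suc) h s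
  bucketSum-∷ β w a h c s = Σ-suc (λ j → if does ((a ∷ᶠ h) j Fin.≟ β) then sgn ((c ∷ᶠ s) j) * w j else 0ℚ)

Linked-shift : ∀ {d} a {xs} → Linked (Gap d) xs → Linked (Gap d) (map (_- a) xs)
Linked-shift a []                     = []
Linked-shift a [-]                    = [-]
Linked-shift {d} a (_∷_ {x} {y} x+d≤y gaps) = subst (_≤ y - a) (swap x d a) (+-monoˡ-≤ (- a) x+d≤y) ∷ Linked-shift a gaps
  where
  swap : ∀ x d a → x + d - a ≡ x - a + d
  swap = solve-∀ ℚ-ring

-- Brings the hash and the sign of coordinate `zero` to the outside together, which isolates the
-- first step of the walk.
𝔼-allFuns-suc₂ : ∀ m (xs : List A) (ys : List B) (F : (Fin (suc m) → A) → (Fin (suc m) → B) → ℚ) →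
  𝔼 (allFuns (suc m) xs) (λ h → 𝔼 (allFuns (suc m) ys) (F h)) ≡
  𝔼 xs (λ a → 𝔼 ys (λ c → 𝔼 (allFuns m xs) (λ h → 𝔼 (allFuns m ys) (λ s → F (a ∷ᶠ h) (c ∷ᶠ s)))))
𝔼-allFuns-suc₂ m xs ys F = begin
  𝔼 (allFuns (suc m) xs) (λ h → 𝔼 (allFuns (suc m) ys) (F h))
    ≡⟨ 𝔼-allFuns-suc m xs (λ h → 𝔼 (allFuns (suc m) ys) (F h)) ⟩
  𝔼 xs (λ a → 𝔼 (allFuns m xs) (λ h → 𝔼 (allFuns (suc m) ys) (F (a ∷ᶠ h))))
    ≡⟨ 𝔼-cong xs (λ a → 𝔼-cong (allFuns m xs) λ h → 𝔼-allFuns-suc m ys (F (a ∷ᶠ h))) ⟩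
  𝔼 xs (λ a → 𝔼 (allFuns m xs) (λ h → 𝔼 ys (λ c → 𝔼 (allFuns m ys) (λ s → F (a ∷ᶠ h) (c ∷ᶠ s)))))
    ≡⟨ 𝔼-cong xs (λ a → 𝔼-swap (allFuns m xs) ys _) ⟩
  𝔼 xs (λ a → 𝔼 ys (λ c → 𝔼 (allFuns m xs) (λ h → 𝔼 (allFuns m ys) (λ s → F (a ∷ᶠ h) (c ∷ᶠ s))))) ∎
  where open ≡-Reasoning

inv≤1 : ∀ b → inv b ≤ 1ℚ
inv≤1 zero    = ≤ᵇ⇒≤ _
inv≤1 (suc b) = subst₂ _≤_ (*-identityˡ _) (ι*inv b) (*-monoʳ (0≤inv (suc b)) (1≤ι b))

module LittlewoodOfford {b} (β : Fin b) (t : ℚ) (0≤t : 0ℚ ≤ t) where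

  private
    d = t + t
    π = inv b

  -- Kleitman's exchange: moving the lowest cell from the down-shifted to the up-shifted family
  -- keeps both families separated, and turns sizes (r , r) into (r + 1 , r − 1).
  exchange : ∀ x xs y w →
    cells d (x ∷ xs) (y + w) + cells d (x ∷ xs) (y - w) ≡
    cells d ((x - w) ∷ map (_- (- w)) (x ∷ xs)) y + cells d (map (_- w) xs) y
  exchange x xs y w = begin
    cells d (x ∷ xs) (y + w) + cells d (x ∷ xs) (y - w)
      ≡⟨ cong₂ _+_ (cells-shift d (x ∷ xs) y w) (cells-shift d (x ∷ xs) y (- w)) ⟩
    cells d (map (_- w) (x ∷ xs)) y + U
      ≡⟨ cong (_+ U) (cells-∷ d (x - w) (map (_- w) xs) y) ⟩
    cell d (x - w) y + cells d (map (_- w) xs) y + U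
      ≡⟨ rearrange (cell d (x - w) y) (cells d (map (_- w) xs) y) U ⟩
    cell d (x - w) y + U + cells d (map (_- w) xs) y
      ≡⟨ cong (_+ cells d (map (_- w) xs) y) (cells-∷ d (x - w) (map (_- (- w)) (x ∷ xs)) y) ⟨
    cells d ((x - w) ∷ map (_- (- w)) (x ∷ xs)) y + cells d (map (_- w) xs) y ∎
    where
    open ≡-Reasoning
    U = cells d (map (_- (- w)) (x ∷ xs)) y
    rearrange : ∀ p q r → p + q + r ≡ p + r + q
    rearrange = solve-∀ ℚ-ring

  -- The added cell starts at x - w and the next one at x + w. Their distance 2w is at least 2t, the
  -- cell width; this is where a large step is needed.
  exchange-gap : ∀ {w} → t ≤ w → ∀ {x xs} → Linked (Gap d) (x ∷ xs) →
    Linked (Gap d) ((x - w) ∷ map (_- (- w)) (x ∷ xs))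
  exchange-gap {w} t≤w {x} gaps = subst (x - w + d ≤_) (rearrange x w) (+-monoʳ-≤ (x - w) (+-mono-≤ t≤w t≤w)) ∷ Linked-shift (- w) gaps
    where
    rearrange : ∀ x w → x - w + (w + w) ≡ x - - w
    rearrange = solve-∀ ℚ-ring

  -- A single cell would not support the induction, so families of disjoint cells are treated and
  -- the state of the walk is their number. A large coordinate that hits the bucket replaces r cells
  -- by r + 1 or r - 1 with equal weight; one that misses it keeps r. An empty family catches
  -- nothing, and at the end of time disjointness gives the bound 1. The offset `x` absorbs steps
  -- that are not exchanged.
  concentration : ∀ m (w : Fin m → ℚ) x {xs} → Linked (Gap d) xs →
    𝔼 (allFuns m (allFin b)) (λ h → 𝔼 (allFuns m bools) (λ s → cells d xs (x + bucketSum β w h s)))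
      ≤ survival π (countAbove t w) (length xs)
  concentration m w x {[]} gaps =
    𝔼-≤ (allFuns m (allFin b)) (IsProb-allFuns m (allFin b) (IsProb-allFin β)) λ h →
    𝔼-≤ (allFuns m bools) (IsProb-allFuns m bools IsProb-bools) λ s → ≤-reflexive (cells-[] d (x + bucketSum β w h s))
  concentration zero w x {_ ∷ _} gaps =
    𝔼-≤ (allFuns 0 (allFin b)) (IsProb-allFuns 0 (allFin b) (IsProb-allFin β)) λ h →
    𝔼-≤ (allFuns 0 bools) (IsProb-allFuns 0 bools IsProb-bools) λ s → cells≤1 (+-nonneg 0≤t 0≤t) gaps (x + bucketSum β w h s)
  concentration (suc m) w x {z ∷ zs} gaps = subst (_≤ survival π (countAbove t w) (length xs)) (sym first-step) bound
    where
    xs = z ∷ zs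
    w′ = w ∘ suc
    N = countAbove t w′

    mean : (ℚ → ℚ) → ℚ
    mean F = 𝔼 (allFuns m (allFin b)) (λ h → 𝔼 (allFuns m bools) (λ s → F (bucketSum β w′ h s)))

    mean-cong : ∀ {F G} → (∀ y → F y ≡ G y) → mean F ≡ mean G
    mean-cong eq = 𝔼-cong (allFuns m (allFin b)) λ h → 𝔼-cong (allFuns m bools) λ s → eq (bucketSum β w′ h s)

    mean-+ : ∀ F G → mean (λ y → F y + G y) ≡ mean F + mean G
    mean-+ F G = trans (𝔼-cong (allFuns m (allFin b)) λ h → 𝔼-+ (allFuns m bools) (λ s → F (bucketSum β w′ h s)) (λ s → G (bucketSum β w′ h s)))
      (𝔼-+ (allFuns m (allFin b)) _ _)

    step : Fin b → Bool → ℚ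
    step a c = if does (a Fin.≟ β) then sgn c * w zero else 0ℚ

    K : ℚ → ℚ
    K v = mean (λ y → cells d xs (x + v + y))

    K≤ : ∀ v → K v ≤ survival π N (length xs)
    K≤ v = concentration m w′ (x + v) gaps

    first-step : 𝔼 (allFuns (suc m) (allFin b)) (λ h → 𝔼 (allFuns (suc m) bools) (λ s → cells d xs (x + bucketSum β w h s)))
           ≡ 𝔼 (allFin b) (λ a → 𝔼 bools (λ c → K (step a c)))
    first-step = trans (𝔼-allFuns-suc₂ m (allFin b) bools (λ h s → cells d xs (x + bucketSum β w h s))) (𝔼-cong (allFin b) λ a → 𝔼-cong bools λ c →
      𝔼-cong (allFuns m (allFin b)) λ h → 𝔼-cong (allFuns m bools) λ s → cong (cells d xs)
        (trans (cong (x +_) (bucketSum-∷ β w a h c s)) (sym (+-assoc x (step a c) (bucketSum β w′ h s)))))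

    bound : 𝔼 (allFin b) (λ a → 𝔼 bools (λ c → K (step a c))) ≤ survival π (countAbove t w) (length xs)
    bound with t ≤? w zero
    -- A weight below `t` leaves the clock unchanged. The induction hypothesis holds for each value
    -- of its step, moved into the offset, and so also for the average.
    ... | no  t≰w rewrite reaches-false t≰w =
      𝔼-≤ (allFin b) (IsProb-allFin β) λ a → 𝔼-≤ bools IsProb-bools λ c → K≤ (step a c)
    ... | yes t≤w rewrite reaches-true t≤w = begin
      𝔼 (allFin b) (λ a → 𝔼 bools (λ c → K (step a c)))
        ≡⟨ 𝔼-cong (allFin b) cases ⟩
      𝔼 (allFin b) (λ a → if does (a Fin.≟ β) then ½ * (K (sgn true * w zero) + K (sgn false * w zero)) else K 0ℚ)
        ≡⟨ 𝔼-single β (½ * (K (sgn true * w zero) + K (sgn false * w zero))) (K 0ℚ) ⟩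
      π * (½ * (K (sgn true * w zero) + K (sgn false * w zero))) + (1ℚ - π) * K 0ℚ
        ≤⟨ +-mono-≤ (*-monoˡ {π} (0≤inv b) (*-monoˡ {½} (≤ᵇ⇒≤ _) two-sided)) (*-monoˡ {1ℚ - π} (0≤q-p (inv≤1 b)) (K≤ 0ℚ)) ⟩
      survival π (suc N) (length xs) ∎
      where
      open ≤-Reasoning
      cases : ∀ a → 𝔼 bools (λ c → K (step a c)) ≡
        (if does (a Fin.≟ β) then ½ * (K (sgn true * w zero) + K (sgn false * w zero)) else K 0ℚ)
      cases a with does (a Fin.≟ β)
      ... | true  = 𝔼-bools (λ c → K (sgn c * w zero))
      ... | false = 𝔼-const bools IsProb-bools (K 0ℚ)
      up : ∀ x v y → x + 1ℚ * v + y ≡ x + y + v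
      up = solve-∀ ℚ-ring
      down : ∀ x v y → x + (- 1ℚ) * v + y ≡ x + y - v
      down = solve-∀ ℚ-ring
      two-sided : K (sgn true * w zero) + K (sgn false * w zero) ≤
        survival π N (suc (length xs)) + survival π N (length zs)
      two-sided = begin
        K (1ℚ * w zero) + K (- 1ℚ * w zero)
          ≡⟨ cong₂ _+_ (mean-cong λ y → cong (cells d xs) (up x (w zero) y))
                       (mean-cong λ y → cong (cells d xs) (down x (w zero) y)) ⟩
        mean (λ y → cells d xs (x + y + w zero)) + mean (λ y → cells d xs (x + y - w zero))
          ≡⟨ mean-+ (λ y → cells d xs (x + y + w zero)) (λ y → cells d xs (x + y - w zero)) ⟨
        mean (λ y → cells d xs (x + y + w zero) + cells d xs (x + y - w zero))
          ≡⟨ mean-cong (λ y → exchange z zs (x + y) (w zero)) ⟩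
        mean (λ y → cells d ((z - w zero) ∷ map (_- (- w zero)) xs) (x + y) + cells d (map (_- w zero) zs) (x + y))
          ≡⟨ mean-+ (λ y → cells d ((z - w zero) ∷ map (_- (- w zero)) xs) (x + y)) (λ y → cells d (map (_- w zero) zs) (x + y)) ⟩
        mean (λ y → cells d ((z - w zero) ∷ map (_- (- w zero)) xs) (x + y)) + mean (λ y → cells d (map (_- w zero) zs) (x + y))
          ≤⟨ +-mono-≤ (concentration m w′ x (exchange-gap t≤w gaps)) (concentration m w′ x (Linked-shift (w zero) (Linked.tail gaps))) ⟩
        survival π N (suc (length (map (_- (- w zero)) xs))) + survival π N (length (map (_- w zero) zs))
          ≡⟨ cong₂ (λ l l′ → survival π N (suc l) + survival π N l′) (length-map (_- (- w zero)) xs) (length-map (_- w zero) zs) ⟩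
        survival π N (suc (length xs)) + survival π N (length zs) ∎

-- Survival probability of the lazy walk

*-mono-nonneg : ∀ {p q r s} → 0ℚ ≤ p → p ≤ q → 0ℚ ≤ r → r ≤ s → p * r ≤ q * s
*-mono-nonneg {p} {q} {r} {s} 0≤p p≤q 0≤r r≤s = ≤-trans (*-monoʳ {r} 0≤r p≤q) (*-monoˡ {q} (≤-trans 0≤p p≤q) r≤s)

module _ {p : ℚ} (0≤p : 0ℚ ≤ p) (p≤1 : p ≤ 1ℚ) where

  survival≤1 : ∀ N r → survival p N r ≤ 1ℚ
  survival≤1 N       zero    = ≤ᵇ⇒≤ _
  survival≤1 zero    (suc r) = ≤-refl
  survival≤1 (suc N) (suc r) = subst (survival p (suc N) (suc r) ≤_) (convex p)
    (+-mono-≤ (*-monoˡ {p} 0≤p (*-monoˡ {½} (≤ᵇ⇒≤ _) (+-mono-≤ (survival≤1 N (suc (suc r))) (survival≤1 N r))))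
              (*-monoˡ {1ℚ - p} (0≤q-p p≤1) (survival≤1 N (suc r))))
    where
    convex : ∀ p → p * (½ * (1ℚ + 1ℚ)) + (1ℚ - p) * 1ℚ ≡ 1ℚ
    convex = solve-∀ ℚ-ring

  -- The walk survives only if it exits the interval (0 , L) at L, which has probability r / L,
  -- or stays inside it up to time N; the mean exit time r (L − r) / p controls the latter.
  survival-bound : ∀ {β u L} → 1ℚ ≤ β → β * p ≡ 1ℚ → 0ℚ ≤ u → ι L * u ≡ 1ℚ → ∀ N r e → r ℕ.+ e ≡ L →
    ι (suc N) * survival p N r ≤ ι (suc N) * (ι r * u) + β * (ι r * ι e)
  survival-bound {β} {u} {L} 1≤β βp 0≤u Lu = go
    where
    0≤β : 0ℚ ≤ β
    0≤β = ≤-trans (≤ᵇ⇒≤ _) 1≤β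

    0≤exit : ∀ r e → 0ℚ ≤ β * (ι r * ι e)
    0≤exit r e = *-nonneg 0≤β (*-nonneg (0≤ι r) (0≤ι e))

    at-end : ∀ N r → r ℕ.+ 0 ≡ L → ∀ {V} → V ≤ 1ℚ → ι (suc N) * V ≤ ι (suc N) * (ι r * u) + β * (ι r * ι 0)
    at-end N r r+0≡L {V} V≤1 = begin
      ι (suc N) * V                                  ≤⟨ *-monoˡ {ι (suc N)} (0≤ι (suc N)) V≤1 ⟩
      ι (suc N) * 1ℚ                                 ≡⟨ cong (ι (suc N) *_) (trans (cong (λ l → ι l * u) (trans (sym (ℕ.+-identityʳ r)) r+0≡L)) Lu) ⟨
      ι (suc N) * (ι r * u)                          ≤⟨ ≤-from-difference (β * (ι r * ι 0)) (0≤exit r 0) refl ⟩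
      ι (suc N) * (ι r * u) + β * (ι r * ι 0)        ∎
      where open ≤-Reasoning

    go : ∀ N r e → r ℕ.+ e ≡ L → ι (suc N) * survival p N r ≤ ι (suc N) * (ι r * u) + β * (ι r * ι e)
    go N zero e r+e≡L = subst (_≤ ι (suc N) * (ι 0 * u) + β * (ι 0 * ι e)) (sym (*-zeroʳ (ι (suc N))))
      (+-nonneg (*-nonneg (0≤ι (suc N)) (*-nonneg (0≤ι 0) 0≤u)) (0≤exit 0 e))
    go N (suc r) zero r+e≡L = at-end N (suc r) r+e≡L (survival≤1 N (suc r))
    -- Strictly inside the interval the factors β, r and e are all at least 1, so the exit-time term
    -- alone covers the probability 1.
    go zero (suc r) (suc e) r+e≡L = begin
      ι 1 * 1ℚ                        ≡⟨ cong (_* 1ℚ) ι-1 ⟩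
      1ℚ * (1ℚ * 1ℚ)                  ≤⟨ *-mono-nonneg {1ℚ} {β} {1ℚ} (≤ᵇ⇒≤ _) 1≤β (≤ᵇ⇒≤ _) (*-mono-nonneg {1ℚ} {ι (suc r)} {1ℚ} (≤ᵇ⇒≤ _) (1≤ι r) (≤ᵇ⇒≤ _) (1≤ι e)) ⟩
      β * (ι (suc r) * ι (suc e))     ≤⟨ ≤-from-difference (ι 1 * (ι (suc r) * u)) (*-nonneg (0≤ι 1) (*-nonneg (0≤ι (suc r)) 0≤u)) (+-comm (ι 1 * (ι (suc r) * u)) (β * (ι (suc r) * ι (suc e)))) ⟩
      ι 1 * (ι (suc r) * u) + β * (ι (suc r) * ι (suc e)) ∎
      where open ≤-Reasoning
    go (suc N) (suc r) (suc e) r+e≡L = begin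
      ι (suc (suc N)) * V                                 ≡⟨ cong (_* V) (ι-suc (suc N)) ⟩
      (1ℚ + n) * V                                        ≡⟨ expand n p S₁ S₂ S₃ ⟩
      V + (p * (½ * (n * S₁ + n * S₂)) + (1ℚ - p) * (n * S₃))
        ≤⟨ +-mono-≤ (survival≤1 (suc N) (suc r))
             (+-mono-≤ (*-monoˡ {p} 0≤p (*-monoˡ {½} (≤ᵇ⇒≤ _) (+-mono-≤ ih₁ ih₂))) (*-monoˡ {1ℚ - p} (0≤q-p p≤1) ih₃)) ⟩
      1ℚ + (p * (½ * ((n * ((1ℚ + (1ℚ + ρ)) * u) + β * ((1ℚ + (1ℚ + ρ)) * ε)) + (n * (ρ * u) + β * (ρ * (1ℚ + (1ℚ + ε))))))
             + (1ℚ - p) * (n * ((1ℚ + ρ) * u) + β * ((1ℚ + ρ) * (1ℚ + ε))))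
        -- The term linear in r is harmonic for the walk, while β r e drops on average by βp = 1 in
        -- one step. That drop pays for the additional summand `V` ≤ 1 which appears when the factor
        -- in front grows by one.
        ≡⟨ collect n p ρ ε β u ⟩
      n * ((1ℚ + ρ) * u) + β * ((1ℚ + ρ) * (1ℚ + ε)) + (1ℚ - β * p)
        ≡⟨ cong (λ z → n * ((1ℚ + ρ) * u) + β * ((1ℚ + ρ) * (1ℚ + ε)) + (1ℚ - z)) βp ⟩
      n * ((1ℚ + ρ) * u) + β * ((1ℚ + ρ) * (1ℚ + ε)) + (1ℚ - 1ℚ)
        ≤⟨ ≤-from-difference ((1ℚ + ρ) * u) (*-nonneg (+-nonneg {1ℚ} {ι r} (≤ᵇ⇒≤ _) (0≤ι r)) 0≤u) (regroup n ρ ε β u) ⟩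
      (1ℚ + n) * ((1ℚ + ρ) * u) + β * ((1ℚ + ρ) * (1ℚ + ε))
        ≡⟨ cong₂ _+_ (cong₂ (λ x y → x * (y * u)) (ι-suc (suc N)) (ι-suc r)) (cong₂ (λ x y → β * (x * y)) (ι-suc r) (ι-suc e)) ⟨
      ι (suc (suc N)) * (ι (suc r) * u) + β * (ι (suc r) * ι (suc e)) ∎
      where
      open ≤-Reasoning
      n = ι (suc N)
      ρ = ι r
      ε = ι e
      S₁ = survival p N (suc (suc r))
      S₂ = survival p N r
      S₃ = survival p N (suc r)
      V = survival p (suc N) (suc r)
      ι-suc² : ∀ n → ι (suc (suc n)) ≡ 1ℚ + (1ℚ + ι n)
      ι-suc² n = trans (ι-suc (suc n)) (cong (1ℚ +_) (ι-suc n))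
      ih₁ : n * S₁ ≤ n * ((1ℚ + (1ℚ + ρ)) * u) + β * ((1ℚ + (1ℚ + ρ)) * ε)
      ih₁ = subst (λ x → n * S₁ ≤ n * (x * u) + β * (x * ε)) (ι-suc² r) (go N (suc (suc r)) e (trans (sym (ℕ.+-suc (suc r) e)) r+e≡L))
      ih₂ : n * S₂ ≤ n * (ρ * u) + β * (ρ * (1ℚ + (1ℚ + ε)))
      ih₂ = subst (λ x → n * S₂ ≤ n * (ρ * u) + β * (ρ * x)) (ι-suc² e) (go N r (suc (suc e)) (trans (ℕ.+-suc r (suc e)) r+e≡L))
      ih₃ : n * S₃ ≤ n * ((1ℚ + ρ) * u) + β * ((1ℚ + ρ) * (1ℚ + ε))
      ih₃ = subst₂ (λ x y → n * S₃ ≤ n * (x * u) + β * (x * y)) (ι-suc r) (ι-suc e) (go N (suc r) (suc e) r+e≡L)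
      expand : ∀ n p S₁ S₂ S₃ → (1ℚ + n) * (p * (½ * (S₁ + S₂)) + (1ℚ - p) * S₃) ≡
        p * (½ * (S₁ + S₂)) + (1ℚ - p) * S₃ + (p * (½ * (n * S₁ + n * S₂)) + (1ℚ - p) * (n * S₃))
      expand = solve-∀ ℚ-ring
      collect : ∀ n p ρ ε β u →
        1ℚ + (p * (½ * ((n * ((1ℚ + (1ℚ + ρ)) * u) + β * ((1ℚ + (1ℚ + ρ)) * ε)) + (n * (ρ * u) + β * (ρ * (1ℚ + (1ℚ + ε))))))
             + (1ℚ - p) * (n * ((1ℚ + ρ) * u) + β * ((1ℚ + ρ) * (1ℚ + ε))))
        ≡ n * ((1ℚ + ρ) * u) + β * ((1ℚ + ρ) * (1ℚ + ε)) + (1ℚ - β * p)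
      collect = solve-∀ ℚ-ring
      regroup : ∀ n ρ ε β u → (1ℚ + n) * ((1ℚ + ρ) * u) + β * ((1ℚ + ρ) * (1ℚ + ε))
        ≡ n * ((1ℚ + ρ) * u) + β * ((1ℚ + ρ) * (1ℚ + ε)) + (1ℚ - 1ℚ) + (1ℚ + ρ) * u
      regroup = solve-∀ ℚ-ring

-- The bound 1/L + 1/(L + 1) on p, where L = e + 1 is the integer part of √(k + 1).
p₀ : ℕ → ℚ
p₀ e = inv (suc e) + inv (suc (suc e))

-- In `survival-bound` with r = 1 and L = e + 1 the exit at L contributes 1/(e + 1). The exit time
-- is at most be, and be ≤ (N + 1)/(e + 2) because e(e + 2)b ≤ kb ≤ N + 1. Taking L close to √k
-- balances the two terms.
survival-at-1 : ∀ b e k N → e ℕ.* suc (suc e) ℕ.≤ k → k ℕ.* suc b ℕ.≤ suc N → survival (inv (suc b)) N 1 ≤ p₀ e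
survival-at-1 b e k N eL≤k kb≤N = *-cancelˡ-≤-pos n {{n-pos}} (begin
  n * survival (inv (suc b)) N 1  ≤⟨ survival-bound (0≤inv (suc b)) (inv≤1 (suc b)) (1≤ι b) (ι*inv b) (0≤inv (suc e)) (ι*inv e) N 1 e refl ⟩
  n * (ι 1 * u) + ι (suc b) * (ι 1 * ι e)  ≡⟨ cong₂ _+_ (cong (λ x → n * (x * u)) ι-1) (cong (λ x → ι (suc b) * (x * ι e)) ι-1) ⟩
  n * (1ℚ * u) + ι (suc b) * (1ℚ * ι e)  ≡⟨ cong (n * (1ℚ * u) +_) (insert (ι (suc b)) (ι e) (ι (suc (suc e))) v (ι*inv (suc e))) ⟩
  n * (1ℚ * u) + ι e * ι (suc (suc e)) * ι (suc b) * v
    ≡⟨ cong (λ x → n * (1ℚ * u) + x * v) (trans (cong (_* ι (suc b)) (sym (ι-* e (suc (suc e))))) (sym (ι-* (e ℕ.* suc (suc e)) (suc b)))) ⟩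
  n * (1ℚ * u) + ι (e ℕ.* suc (suc e) ℕ.* suc b) * v
    ≤⟨ +-monoʳ-≤ (n * (1ℚ * u)) (*-monoʳ {v} (0≤inv (suc (suc e))) (ι-mono (ℕ.≤-trans (ℕ.*-monoˡ-≤ (suc b) eL≤k) kb≤N))) ⟩
  n * (1ℚ * u) + n * v  ≡⟨ factor n u v ⟩
  n * (u + v) ∎)
  where
  open ≤-Reasoning
  n = ι (suc N)
  u = inv (suc e)
  v = inv (suc (suc e))
  n-pos : Positive n
  n-pos = positive (<-≤-trans (positive⁻¹ 1ℚ) (1≤ι N))
  insert : ∀ β ε l v → l * v ≡ 1ℚ → β * (1ℚ * ε) ≡ ε * l * β * v
  insert β ε l v lv = trans (cong (λ x → β * (x * ε)) (sym lv)) (shuffle β ε l v)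
    where
    shuffle : ∀ β ε l v → β * (l * v * ε) ≡ ε * l * β * v
    shuffle = solve-∀ ℚ-ring
  factor : ∀ n u v → n * (1ℚ * u) + n * v ≡ n * (u + v)
  factor = solve-∀ ℚ-ring

0≤1 : 0ℚ ≤ 1ℚ
0≤1 = ≤ᵇ⇒≤ _

0≤½ : 0ℚ ≤ ½
0≤½ = ≤ᵇ⇒≤ _

-- Binomial tails

^-nonneg : ∀ {x} → 0ℚ ≤ x → ∀ n → 0ℚ ≤ x ^ n
^-nonneg 0≤x zero    = 0≤1
^-nonneg 0≤x (suc n) = *-nonneg 0≤x (^-nonneg 0≤x n)

^-pos : ∀ {x} → 0ℚ < x → ∀ n → 0ℚ < x ^ n
^-pos 0<x zero    = positive⁻¹ 1ℚ
^-pos {x} 0<x (suc n) = positive⁻¹ (x * x ^ n) {{pos*pos⇒pos x {{positive 0<x}} (x ^ n) {{positive (^-pos 0<x n)}}}}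

^-mono : ∀ {x y} → 0ℚ ≤ x → x ≤ y → ∀ n → x ^ n ≤ y ^ n
^-mono 0≤x x≤y zero    = ≤-refl
^-mono 0≤x x≤y (suc n) = *-mono-nonneg 0≤x x≤y (^-nonneg 0≤x n) (^-mono 0≤x x≤y n)

^≤1 : ∀ {x} → 0ℚ ≤ x → x ≤ 1ℚ → ∀ n → x ^ n ≤ 1ℚ
^≤1 0≤x x≤1 zero    = ≤-refl
^≤1 {x} 0≤x x≤1 (suc n) = *-mono-nonneg {x} {1ℚ} {x ^ n} {1ℚ} 0≤x x≤1 (^-nonneg 0≤x n) (^≤1 0≤x x≤1 n)

^-antitone : ∀ {x} → 0ℚ ≤ x → x ≤ 1ℚ → ∀ {m n} → m ℕ.≤ n → x ^ n ≤ x ^ m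
^-antitone 0≤x x≤1 {n = n} ℕ.z≤n = ^≤1 0≤x x≤1 n
^-antitone {x} 0≤x x≤1 (ℕ.s≤s m≤n) = *-monoˡ {x} 0≤x (^-antitone 0≤x x≤1 m≤n)

module _ {z : ℚ} (0≤z : 0ℚ ≤ z) (z≤1 : z ≤ 1ℚ) where

  bernoulli : ∀ n → 1ℚ - ι n * z ≤ (1ℚ - z) ^ n
  bernoulli zero    = ≤-reflexive (trans (cong (λ x → 1ℚ - x * z) ι-0) (base z))
    where
    base : ∀ z → 1ℚ - 0ℚ * z ≡ 1ℚ
    base = solve-∀ ℚ-ring
  bernoulli (suc n) = begin
    1ℚ - ι (suc n) * z                      ≡⟨ cong (λ x → 1ℚ - x * z) (ι-suc n) ⟩
    1ℚ - (1ℚ + ι n) * z                     ≤⟨ ≤-from-difference (ι n * (z * z)) (*-nonneg (0≤ι n) (square-nonneg z)) (expand (ι n) z) ⟩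
    (1ℚ - z) * (1ℚ - ι n * z)               ≤⟨ *-monoˡ {1ℚ - z} (0≤q-p z≤1) (bernoulli n) ⟩
    (1ℚ - z) * (1ℚ - z) ^ n                 ∎
    where
    open ≤-Reasoning
    expand : ∀ n z → (1ℚ - z) * (1ℚ - n * z) ≡ 1ℚ - (1ℚ + n) * z + n * (z * z)
    expand = solve-∀ ℚ-ring

  -- A division-free substitute for (1 - z)^n ≤ e^(-nz), good enough for one fixed n. The induction
  -- rests on (1 - z)(1 + (n + 1)z) = 1 + nz - (n + 1)z².
  bernoulli-upper : ∀ n → (1ℚ - z) ^ n * (1ℚ + ι n * z) ≤ 1ℚ
  bernoulli-upper zero    = ≤-reflexive (trans (cong (λ x → 1ℚ * (1ℚ + x * z)) ι-0) (base z))
    where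
    base : ∀ z → 1ℚ * (1ℚ + 0ℚ * z) ≡ 1ℚ
    base = solve-∀ ℚ-ring
  bernoulli-upper (suc n) = begin
    (1ℚ - z) * (1ℚ - z) ^ n * (1ℚ + ι (suc n) * z)   ≡⟨ cong (λ x → (1ℚ - z) * (1ℚ - z) ^ n * (1ℚ + x * z)) (ι-suc n) ⟩
    (1ℚ - z) * (1ℚ - z) ^ n * (1ℚ + (1ℚ + ι n) * z)
      ≤⟨ ≤-from-difference ((1ℚ - z) ^ n * ((1ℚ + ι n) * (z * z)))
           (*-nonneg (^-nonneg (0≤q-p z≤1) n) (*-nonneg (+-nonneg {1ℚ} {ι n} 0≤1 (0≤ι n)) (square-nonneg z)))
           (expand ((1ℚ - z) ^ n) (ι n) z) ⟩
    (1ℚ - z) ^ n * (1ℚ + ι n * z)                    ≤⟨ bernoulli-upper n ⟩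
    1ℚ                                               ∎
    where
    open ≤-Reasoning
    expand : ∀ x n z → x * (1ℚ + n * z) ≡ (1ℚ - z) * x * (1ℚ + (1ℚ + n) * z) + x * ((1ℚ + n) * (z * z))
    expand = solve-∀ ℚ-ring

inv-antitone : ∀ {m n} → m ℕ.≤ n → inv (suc n) ≤ inv (suc m)
inv-antitone {m} {n} m≤n = *-cancelˡ-≤-pos (ι (suc n)) {{positive (<-≤-trans (positive⁻¹ 1ℚ) (1≤ι n))}} (begin
  ι (suc n) * inv (suc n)  ≡⟨ trans (ι*inv n) (sym (ι*inv m)) ⟩
  ι (suc m) * inv (suc m)  ≤⟨ *-monoʳ {inv (suc m)} (0≤inv (suc m)) (ι-mono (ℕ.s≤s m≤n)) ⟩
  ι (suc n) * inv (suc m)  ∎)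
  where open ≤-Reasoning

-- Where the exponent comes from: for z = 1/(2L²) one has p₀² ≤ 8z and 1 − p₀² ≥ 11/36, so that
-- (1 − p₀²)(1 + 27z) ≥ 1 and hence (1 − z)²⁷ ≤ 1 − p₀²; moreover k ≤ 2L² and (1 − z)^(L²) ≥ ½.
opaque
  ½⁵⁴ : ℚ
  ½⁵⁴ = ½ ^ 54

  ½⁵⁴≡ : ½⁵⁴ ≡ ½ ^ 54
  ½⁵⁴≡ = refl

  0<½⁵⁴ : 0ℚ < ½⁵⁴
  0<½⁵⁴ = ^-pos (positive⁻¹ ½) 54

module _ {e : ℕ} (1≤e : 1 ℕ.≤ e) where

  private
    L = suc e
    u = inv L
    v = inv (suc L)
    y = p₀ e * p₀ e
    z = ½ * (u * u)
    u≤½ : u ≤ inv 2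
    u≤½ = inv-antitone 1≤e
    v≤⅓ : v ≤ inv 3
    v≤⅓ = inv-antitone (ℕ.s≤s 1≤e)

  0≤p₀ : 0ℚ ≤ p₀ e
  0≤p₀ = +-nonneg (0≤inv L) (0≤inv (suc L))

  -- The worst case e = 1 gives 1/2 + 1/3 = 5/6. The hypothesis k ≥ 3 enters through e ≥ 1; at e = 0
  -- the value would be 3/2.
  p₀≤1 : p₀ e ≤ 1ℚ
  p₀≤1 = ≤-trans (+-mono-≤ u≤½ v≤⅓) (≤ᵇ⇒≤ _)

  1-p₀²≥0 : 0ℚ ≤ 1ℚ - y
  1-p₀²≥0 = 0≤q-p (*-mono-nonneg {p₀ e} {1ℚ} {p₀ e} {1ℚ} 0≤p₀ p₀≤1 0≤p₀ p₀≤1)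

  private
    z≤1 : z ≤ 1ℚ
    z≤1 = ≤-trans (*-monoˡ {½} 0≤½ (*-mono-nonneg (0≤inv L) u≤½ (0≤inv L) u≤½)) (≤ᵇ⇒≤ _)

    0≤z : 0ℚ ≤ z
    0≤z = *-nonneg 0≤½ (square-nonneg u)

    y≤8z : y ≤ ι 8 * z
    y≤8z = begin
      p₀ e * p₀ e               ≤⟨ *-mono-nonneg 0≤p₀ p₀≤2u 0≤p₀ p₀≤2u ⟩
      (u + u) * (u + u)         ≡⟨ expand u ⟩
      (ι 8 * ½) * (u * u)       ≡⟨ *-assoc (ι 8) ½ (u * u) ⟩
      ι 8 * z ∎
      where
      open ≤-Reasoning
      p₀≤2u : p₀ e ≤ u + u
      p₀≤2u = +-monoʳ-≤ u (inv-antitone (ℕ.n≤1+n e))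
      expand′ : ∀ u → (u + u) * (u + u) ≡ (1ℚ + 1ℚ + 1ℚ + 1ℚ) * (u * u)
      expand′ = solve-∀ ℚ-ring
      expand : ∀ u → (u + u) * (u + u) ≡ (ι 8 * ½) * (u * u)
      expand u = trans (expand′ u) (cong (_* (u * u)) (cong (_* ½) (sym (ι≡ 8))))

    y≤25/36 : y ≤ (inv 2 + inv 3) * (inv 2 + inv 3)
    y≤25/36 = *-mono-nonneg 0≤p₀ (+-mono-≤ u≤½ v≤⅓) 0≤p₀ (+-mono-≤ u≤½ v≤⅓)

    power≤ : (1ℚ - z) ^ 27 ≤ 1ℚ - y
    power≤ = *-cancelʳ-≤-pos (1ℚ + ι 27 * z) {{positive (<-≤-trans (positive⁻¹ 1ℚ) 1≤)}} (begin
      (1ℚ - z) ^ 27 * (1ℚ + ι 27 * z)   ≤⟨ bernoulli-upper 0≤z z≤1 27 ⟩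
      1ℚ                                ≤⟨ ≤-from-difference ((1ℚ - y) * (ι 27 * z) - y) (0≤q-p slack) (expand y (ι 27 * z)) ⟩
      (1ℚ - y) * (1ℚ + ι 27 * z)        ∎)
      where
      open ≤-Reasoning
      1≤ : 1ℚ ≤ 1ℚ + ι 27 * z
      1≤ = ≤-from-difference (ι 27 * z) (*-nonneg (0≤ι 27) 0≤z) refl
      expand : ∀ y w → (1ℚ - y) * (1ℚ + w) ≡ 1ℚ + ((1ℚ - y) * w - y)
      expand = solve-∀ ℚ-ring
      -- The right side is 27 · 11/36 = 8.25; with 26 in place of 27 it would fall below 8.
      constant : ι 8 ≤ (1ℚ - (inv 2 + inv 3) * (inv 2 + inv 3)) * ι 27
      constant = subst₂ (λ a c → a ≤ (1ℚ - (inv 2 + inv 3) * (inv 2 + inv 3)) * c) (sym (ι≡ 8)) (sym (ι≡ 27)) (≤ᵇ⇒≤ _)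
      slack : y ≤ (1ℚ - y) * (ι 27 * z)
      slack = begin
        y                                 ≤⟨ y≤8z ⟩
        ι 8 * z                           ≤⟨ *-monoʳ {z} 0≤z constant ⟩
        (1ℚ - (inv 2 + inv 3) * (inv 2 + inv 3)) * ι 27 * z  ≡⟨ *-assoc (1ℚ - (inv 2 + inv 3) * (inv 2 + inv 3)) (ι 27) z ⟩
        (1ℚ - (inv 2 + inv 3) * (inv 2 + inv 3)) * (ι 27 * z)  ≤⟨ *-monoʳ {ι 27 * z} (*-nonneg (0≤ι 27) 0≤z) (+-monoʳ-≤ 1ℚ (neg-antimono-≤ y≤25/36)) ⟩
        (1ℚ - y) * (ι 27 * z)             ∎

    half≤ : ½ ≤ (1ℚ - z) ^ (L ℕ.* L)
    half≤ = subst (_≤ (1ℚ - z) ^ (L ℕ.* L)) half (bernoulli 0≤z z≤1 (L ℕ.* L))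
      where
      shuffle : ∀ l u → l * l * (½ * (u * u)) ≡ ½ * ((l * u) * (l * u))
      shuffle = solve-∀ ℚ-ring
      half : 1ℚ - ι (L ℕ.* L) * z ≡ ½
      half = cong (λ x → 1ℚ - x) (trans (cong (_* z) (ι-* L L)) (trans (shuffle (ι L) u) (cong (λ x → ½ * (x * x)) (ι*inv e))))

  power-bound : ∀ {k} → k ℕ.≤ 2 ℕ.* (L ℕ.* L) → ½⁵⁴ ≤ (1ℚ - p₀ e * p₀ e) ^ k
  power-bound {k} k≤ = begin
    ½⁵⁴                                 ≡⟨ ½⁵⁴≡ ⟩
    ½ ^ 54                              ≤⟨ ^-mono 0≤½ half≤ 54 ⟩
    ((1ℚ - z) ^ (L ℕ.* L)) ^ 54         ≡⟨ ^-assocʳ (1ℚ - z) (L ℕ.* L) 54 ⟩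
    (1ℚ - z) ^ (L ℕ.* L ℕ.* 54)         ≡⟨ cong ((1ℚ - z) ^_) (exponents (L ℕ.* L)) ⟩
    (1ℚ - z) ^ (27 ℕ.* (2 ℕ.* (L ℕ.* L)))  ≡⟨ ^-assocʳ (1ℚ - z) 27 (2 ℕ.* (L ℕ.* L)) ⟨
    ((1ℚ - z) ^ 27) ^ (2 ℕ.* (L ℕ.* L)) ≤⟨ ^-mono (^-nonneg (0≤q-p z≤1) 27) power≤ (2 ℕ.* (L ℕ.* L)) ⟩
    (1ℚ - y) ^ (2 ℕ.* (L ℕ.* L))        ≤⟨ ^-antitone 1-p₀²≥0 (≤-from-difference y (square-nonneg (p₀ e)) (rearrange y)) k≤ ⟩
    (1ℚ - y) ^ k                        ∎
    where
    open ≤-Reasoning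
    exponents : ∀ n → n ℕ.* 54 ≡ 27 ℕ.* (2 ℕ.* n)
    exponents = ℕ-solve-∀
    rearrange : ∀ y → 1ℚ ≡ 1ℚ - y + y
    rearrange = solve-∀ ℚ-ring

-- Fair and biased coin tossing

binTail : ℚ → ℕ → ℕ → ℚ
binTail q k       zero    = 1ℚ
binTail q zero    (suc r) = 0ℚ
binTail q (suc k) (suc r) = q * binTail q k r + (1ℚ - q) * binTail q k (suc r)

binTail-large : ∀ q {k r} → k ℕ.< r → binTail q k r ≡ 0ℚ
binTail-large q {zero}  (ℕ.s≤s _)   = refl
binTail-large q {suc k} (ℕ.s≤s k<r) = trans
  (cong₂ (λ x y → q * x + (1ℚ - q) * y) (binTail-large q k<r) (binTail-large q (ℕ.m≤n⇒m≤1+n k<r))) (zeros q)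
  where
  zeros : ∀ q → q * 0ℚ + (1ℚ - q) * 0ℚ ≡ 0ℚ
  zeros = solve-∀ ℚ-ring

-- A fair coin may swap heads and tails, and having at least r heads is the opposite of having at
-- least k + 1 - r tails. For odd k the choice r = (k + 1)/2 is paired with itself.
binTail-symmetric : ∀ k r r′ → r ℕ.+ r′ ≡ suc k → binTail ½ k r + binTail ½ k r′ ≡ 1ℚ
binTail-symmetric k       zero    r′       eq = trans (cong (1ℚ +_) (binTail-large ½ (ℕ.≤-reflexive (sym eq)))) (+-identityʳ 1ℚ)
binTail-symmetric k       (suc r) zero     eq = trans (cong (_+ 1ℚ) (binTail-large ½ (ℕ.≤-reflexive (trans (sym eq) (ℕ.+-identityʳ (suc r)))))) (+-identityˡ 1ℚ)
binTail-symmetric zero    (suc r) (suc r′) eq = contradiction (trans (sym (ℕ.+-suc r r′)) (ℕ.suc-injective eq)) λ ()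
binTail-symmetric (suc k) (suc r) (suc r′) eq = begin
  ½ * T r + (1ℚ - ½) * T (suc r) + (½ * T r′ + (1ℚ - ½) * T (suc r′))  ≡⟨ regroup (T r) (T (suc r)) (T r′) (T (suc r′)) ⟩
  ½ * (T r + T (suc r′)) + ½ * (T (suc r) + T r′)
    ≡⟨ cong₂ (λ x y → ½ * x + ½ * y) (binTail-symmetric k r (suc r′) (ℕ.suc-injective eq))
                                     (binTail-symmetric k (suc r) r′ (trans (sym (ℕ.+-suc r r′)) (ℕ.suc-injective eq))) ⟩
  1ℚ ∎
  where
  open ≡-Reasoning
  T = binTail ½ k
  regroup : ∀ a b c d → ½ * a + (1ℚ - ½) * b + (½ * c + (1ℚ - ½) * d) ≡ ½ * (a + d) + ½ * (b + c)
  regroup = solve-∀ ℚ-ring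

binTail-median : ∀ {k r} → r ℕ.+ r ≡ suc k → binTail ½ k r ≡ ½
binTail-median {k} {r} eq = begin
  T                ≡⟨ double T ⟩
  ½ * (T + T)      ≡⟨ cong (½ *_) (binTail-symmetric k r r eq) ⟩
  ½                ∎
  where
  open ≡-Reasoning
  T = binTail ½ k r
  double : ∀ x → x ≡ ½ * (x + x)
  double = solve-∀ ℚ-ring

-- Tensorised Cauchy–Schwarz: passing from the fair to the q-biased coin costs a factor 4q(1 − q)
-- per toss (the inverse of 1 + χ²) and a square.
module _ {q : ℚ} (0≤q : 0ℚ ≤ q) (q≤1 : q ≤ 1ℚ) where

  private
    D = (q + q) * ((1ℚ - q) + (1ℚ - q))

    0≤D : 0ℚ ≤ D
    0≤D = *-nonneg (+-nonneg 0≤q 0≤q) (+-nonneg (0≤q-p q≤1) (0≤q-p q≤1))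

    D≤1 : D ≤ 1ℚ
    D≤1 = ≤-from-difference ((1ℚ - q - q) * (1ℚ - q - q)) (square-nonneg (1ℚ - q - q)) (expand q)
      where
      expand : ∀ q → 1ℚ ≡ (q + q) * ((1ℚ - q) + (1ℚ - q)) + (1ℚ - q - q) * (1ℚ - q - q)
      expand = solve-∀ ℚ-ring

  binTail-tilt : ∀ k r → D ^ k * (binTail ½ k r * binTail ½ k r) ≤ binTail q k r
  binTail-tilt k       zero    = subst (_≤ 1ℚ) (sym (*-identityʳ (D ^ k))) (^≤1 0≤D D≤1 k)
  binTail-tilt zero    (suc r) = ≤-refl
  binTail-tilt (suc k) (suc r) = begin
    D * D ^ k * ((½ * x + (1ℚ - ½) * y) * (½ * x + (1ℚ - ½) * y))
      -- Cauchy-Schwarz on two points, with its defect made explicit: q(1 - q)(x + y)² = qx² + (1 -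
      -- q)y² - (qx - (1 - q)y)².
      ≤⟨ ≤-from-difference (D ^ k * (s * s)) (*-nonneg (^-nonneg 0≤D k) (square-nonneg s)) (expand q (D ^ k) x y) ⟩
    q * (D ^ k * (x * x)) + (1ℚ - q) * (D ^ k * (y * y))
      ≤⟨ +-mono-≤ (*-monoˡ {q} 0≤q (binTail-tilt k r)) (*-monoˡ {1ℚ - q} (0≤q-p q≤1) (binTail-tilt k (suc r))) ⟩
    q * binTail q k r + (1ℚ - q) * binTail q k (suc r) ∎
    where
    open ≤-Reasoning
    x = binTail ½ k r
    y = binTail ½ k (suc r)
    s = q * x - (1ℚ - q) * y
    expand : ∀ q P x y → q * (P * (x * x)) + (1ℚ - q) * (P * (y * y)) ≡
      (q + q) * ((1ℚ - q) + (1ℚ - q)) * P * ((½ * x + (1ℚ - ½) * y) * (½ * x + (1ℚ - ½) * y))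
        + P * ((q * x - (1ℚ - q) * y) * (q * x - (1ℚ - q) * y))
    expand = solve-∀ ℚ-ring

atLeast : ℕ → ∀ {k} → (Fin k → Bool) → Bool
atLeast zero    c = true
atLeast (suc r) {zero}  c = false
atLeast (suc r) {suc k} c = if c zero then atLeast r (c ∘ suc) else atLeast (suc r) (c ∘ suc)

atLeast-weaken : ∀ r {k} (c : Fin k → Bool) → indicator (atLeast (suc r) c) ≤ indicator (atLeast r c)
atLeast-weaken zero    c = indicator≤1 (atLeast 1 c)
atLeast-weaken (suc r) {zero}  c = ≤-refl
atLeast-weaken (suc r) {suc k} c with c zero
... | true  = atLeast-weaken r (c ∘ suc)
... | false = atLeast-weaken (suc r) (c ∘ suc)

-- Stochastic domination by conditioning on the first draw. The conditional probabilities are `P`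
-- after a hit and `P⁺` after a miss, and `P⁺` ≤ `P`, so their mixture grows with the probability of
-- a hit.
binTail≤𝔼 : ∀ {xs : List A} → IsProb xs → (g : A → Bool) → ∀ {q} → q ≤ 𝔼 xs (indicator ∘ g) → 0ℚ ≤ q → q ≤ 1ℚ →
  ∀ k r → binTail q k r ≤ 𝔼 (allFuns k xs) (λ ω → indicator (atLeast r (g ∘ ω)))
binTail≤𝔼 {xs = xs} prob g {q} q≤ 0≤q q≤1 = go
  where
  go : ∀ k r → binTail q k r ≤ 𝔼 (allFuns k xs) (λ ω → indicator (atLeast r (g ∘ ω)))
  go k       zero    = ≤-reflexive (sym (IsProb.total (IsProb-allFuns k xs prob)))
  go zero    (suc r) = ≤-reflexive (sym (𝔼-const (allFuns 0 xs) (IsProb-allFuns 0 xs prob) 0ℚ))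
  go (suc k) (suc r) = begin
    q * binTail q k r + (1ℚ - q) * binTail q k (suc r)
      ≤⟨ +-mono-≤ (*-monoˡ {q} 0≤q (go k r)) (*-monoˡ {1ℚ - q} (0≤q-p q≤1) (go k (suc r))) ⟩
    q * P + (1ℚ - q) * P⁺                   ≡⟨ regroup q P P⁺ ⟩
    (P - P⁺) * q + P⁺                       ≤⟨ +-monoˡ-≤ P⁺ (*-monoˡ {P - P⁺} (0≤q-p P⁺≤P) q≤) ⟩
    (P - P⁺) * 𝔼 xs (indicator ∘ g) + P⁺    ≡⟨ cong₂ _+_ (𝔼-* xs (P - P⁺) (indicator ∘ g)) (𝔼-const xs prob P⁺) ⟨
    𝔼 xs (λ a → (P - P⁺) * indicator (g a)) + 𝔼 xs (λ _ → P⁺)  ≡⟨ 𝔼-+ xs (λ a → (P - P⁺) * indicator (g a)) (λ _ → P⁺) ⟨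
    𝔼 xs (λ a → (P - P⁺) * indicator (g a) + P⁺)  ≡⟨ 𝔼-cong xs cases ⟩
    𝔼 xs (λ a → 𝔼 (allFuns k xs) (λ ω → indicator (atLeast (suc r) (g ∘ (a ∷ᶠ ω)))))  ≡⟨ 𝔼-allFuns-suc k xs (λ ω → indicator (atLeast (suc r) (g ∘ ω))) ⟨
    𝔼 (allFuns (suc k) xs) (λ ω → indicator (atLeast (suc r) (g ∘ ω))) ∎
    where
    open ≤-Reasoning
    P = 𝔼 (allFuns k xs) (λ ω → indicator (atLeast r (g ∘ ω)))
    P⁺ = 𝔼 (allFuns k xs) (λ ω → indicator (atLeast (suc r) (g ∘ ω)))
    P⁺≤P : P⁺ ≤ P
    P⁺≤P = 𝔼-mono (allFuns k xs) (λ ω → atLeast-weaken r (g ∘ ω))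
    regroup : ∀ q p p′ → q * p + (1ℚ - q) * p′ ≡ (p - p′) * q + p′
    regroup = solve-∀ ℚ-ring
    on : ∀ p p′ → (p - p′) * 1ℚ + p′ ≡ p
    on = solve-∀ ℚ-ring
    off : ∀ p p′ → (p - p′) * 0ℚ + p′ ≡ p′
    off = solve-∀ ℚ-ring
    cases : ∀ a → (P - P⁺) * indicator (g a) + P⁺ ≡ 𝔼 (allFuns k xs) (λ ω → indicator (atLeast (suc r) (g ∘ (a ∷ᶠ ω))))
    cases a with g a
    ... | true  = on P P⁺
    ... | false = off P P⁺

-- Medians and rows

count : ℚ → List ℚ → ℕ
count θ xs = length (filter (θ ≤?_) xs)

sorted⇒head≤nth : ∀ {x xs} → Linked _≤_ (x ∷ xs) → ∀ {j} → j ℕ.< length xs → x ≤ nth xs j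
sorted⇒head≤nth [-]          ()
sorted⇒head≤nth (x≤y ∷ ys↗) {zero}  _         = x≤y
sorted⇒head≤nth (x≤y ∷ ys↗) {suc j} (s≤s j<n) = ≤-trans x≤y (sorted⇒head≤nth ys↗ j<n)

-- In a sorted list the entries that are at least `θ` form a final segment, and the last hypothesis
-- says that it begins at index `j` or earlier.
count⇒≤nth : ∀ θ {xs} → Linked _≤_ xs → ∀ j → j ℕ.< length xs → length xs ℕ.≤ j ℕ.+ count θ xs → θ ≤ nth xs j
count⇒≤nth θ {x ∷ xs} xs↗ j j<n n≤ with θ ≤? x
count⇒≤nth θ {x ∷ xs} xs↗ zero    j<n       n≤ | yes θ≤x = θ≤x
count⇒≤nth θ {x ∷ xs} xs↗ (suc j) (s≤s j<n) n≤ | yes θ≤x = ≤-trans θ≤x (sorted⇒head≤nth xs↗ j<n)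
-- For index 0 every entry would have to count, but the head does not.
count⇒≤nth θ {x ∷ xs} xs↗ zero    j<n       n≤ | no  θ≰x =
  contradiction (ℕ.≤-trans n≤ (subst (ℕ._≤ length xs) (cong length (sym (filter-reject (θ ≤?_) θ≰x))) (length-filter (θ ≤?_) xs))) ℕ.1+n≰n
count⇒≤nth θ {x ∷ xs} xs↗ (suc j) (s≤s j<n) n≤ | no  θ≰x = count⇒≤nth θ (Linked.tail xs↗) j j<n
  (ℕ.s≤s⁻¹ (subst (λ l → suc (length xs) ℕ.≤ suc j ℕ.+ length l) (filter-reject (θ ≤?_) θ≰x) n≤))

count⇒≤median : ∀ θ xs → length xs ℕ./ 2 ℕ.< length xs → length xs ℕ.≤ length xs ℕ./ 2 ℕ.+ count θ xs → θ ≤ median xs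
count⇒≤median θ xs h<n n≤ = count⇒≤nth θ (sort-↗ xs) (length xs ℕ./ 2)
  (subst (length xs ℕ./ 2 ℕ.<_) (sym same-length) h<n)
  (subst₂ (λ n c → n ℕ.≤ length xs ℕ./ 2 ℕ.+ c) (sym same-length) (sym (↭-length (filter-↭ (θ ≤?_) (sort-↭ xs)))) n≤)
  where
  same-length : length (sort xs) ≡ length xs
  same-length = ↭-length (sort-↭ xs)

atLeast⇒count : ∀ θ r {k} (x : Fin k → ℚ) → atLeast r (reaches θ ∘ x) ≡ true → r ℕ.≤ count θ (tabulate x)
atLeast⇒count θ zero    x eq = z≤n
atLeast⇒count θ (suc r) {suc k} x eq with θ ≤? x zero
... | yes θ≤x = subst (λ l → suc r ℕ.≤ length l) (sym (filter-accept (θ ≤?_) θ≤x)) (s≤s (atLeast⇒count θ r (x ∘ suc)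
  (trans (cong (λ c → if c then atLeast r (reaches θ ∘ x ∘ suc) else atLeast (suc r) (reaches θ ∘ x ∘ suc)) (sym (reaches-true θ≤x))) eq)))
... | no  θ≰x = subst (λ l → suc r ℕ.≤ length l) (sym (filter-reject (θ ≤?_) θ≰x)) (atLeast⇒count θ (suc r) (x ∘ suc)
  (trans (cong (λ c → if c then atLeast r (reaches θ ∘ x ∘ suc) else atLeast (suc r) (reaches θ ∘ x ∘ suc)) (sym (reaches-false θ≰x))) eq))

-- With k = 2h + 1 the median has index h, so h + 1 rows above the threshold lift it over f_i + t.
-- Otherwise the error is bounded below by 0, and the indicator form is ready for taking
-- expectations.
median-error : ∀ B₁ {k m b} (ω : Outcome k m b) (i : Fin m) {t} → 0ℚ ≤ t → k ≡ 1 ℕ.+ k ℕ./ 2 ℕ.* 2 →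
  t * indicator (atLeast (suc (k ℕ./ 2)) (λ ℓ → reaches (fval B₁ i + t) (rowEst B₁ (ω ℓ) i)))
    ≤ ∣ ftilde B₁ ω i - fval B₁ i ∣
median-error B₁ {k} ω i {t} 0≤t odd with atLeast (suc (k ℕ./ 2)) (λ ℓ → reaches (fval B₁ i + t) (rowEst B₁ (ω ℓ) i)) in eq
... | false = subst (_≤ ∣ ftilde B₁ ω i - fval B₁ i ∣) (sym (*-zeroʳ t)) (0≤∣p∣ (ftilde B₁ ω i - fval B₁ i))
... | true  = begin
  t * 1ℚ                          ≡⟨ *-identityʳ t ⟩
  t                               ≡⟨ cancel f t ⟩
  f + t - f                       ≤⟨ +-monoˡ-≤ (- f) θ≤median ⟩
  ftilde B₁ ω i - f               ≡⟨ 0≤p⇒∣p∣≡p 0≤error ⟨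
  ∣ ftilde B₁ ω i - f ∣           ∎
  where
  open ≤-Reasoning
  f = fval B₁ i
  h = k ℕ./ 2
  xs = map (λ ℓ → rowEst B₁ (ω ℓ) i) (allFin k)
  x : Fin k → ℚ
  x ℓ = rowEst B₁ (ω ℓ) i
  xs≡ : xs ≡ tabulate x
  xs≡ = map-tabulate id x
  length-xs : length xs ≡ k
  length-xs = trans (cong length xs≡) (length-tabulate x)
  cancel : ∀ f t → t ≡ f + t - f
  cancel = solve-∀ ℚ-ring
  double : ∀ h → 1 ℕ.+ h ℕ.* 2 ≡ h ℕ.+ suc h
  double = ℕ-solve-∀
  k≡ : k ≡ h ℕ.+ suc h
  k≡ = trans odd (double h)
  θ≤median : f + t ≤ median xs
  θ≤median = count⇒≤median (f + t) xs
    (subst (λ n → n ℕ./ 2 ℕ.< n) (sym length-xs) (subst (h ℕ.<_) (sym k≡) (ℕ.m≤n+m (suc h) h)))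
    (subst (λ n → n ℕ.≤ n ℕ./ 2 ℕ.+ count (f + t) xs) (sym length-xs)
      (ℕ.≤-trans (ℕ.≤-reflexive k≡) (ℕ.+-monoʳ-≤ h (subst (λ l → suc h ℕ.≤ count (f + t) l) (sym xs≡) (atLeast⇒count (f + t) (suc h) x eq)))))
  0≤error : 0ℚ ≤ ftilde B₁ ω i - f
  0≤error = ≤-trans 0≤t (≤-trans (≤-reflexive (cancel f t)) (+-monoˡ-≤ (- f) θ≤median))

-- Distribution of a single row

sgn²≡1 : ∀ c → sgn c * sgn c ≡ 1ℚ
sgn²≡1 true  = refl
sgn²≡1 false = refl

-- Weight 0 in place of a deleted index: the index type stays `Fin m`, and the hash and sign at `i`
-- no longer affect the sum over a fixed bucket.
erase : ∀ {m} → Fin m → (Fin m → ℚ) → Fin m → ℚ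
erase i f j = if does (j Fin.≟ i) then 0ℚ else f j

erase-self : ∀ {m} (i : Fin m) f → erase i f i ≡ 0ℚ
erase-self i f = cong (λ c → if c then 0ℚ else f i) (dec-true (i Fin.≟ i) refl)

erase-other : ∀ {m} {i j : Fin m} f → j ≢ i → erase i f j ≡ f j
erase-other {i = i} {j} f j≢i = cong (λ c → if c then 0ℚ else f j) (dec-false (j Fin.≟ i) j≢i)

-- Index `i` always collides with itself, and there its sign is squared away. In the remaining noise
-- it has weight 0, so the old `s` may stand there.
rowEst-resample : ∀ B₁ {m b} (h : Fin m → Fin b) s i c →
  rowEst B₁ (h , updateAt s i (const c)) i ≡ fval B₁ i + sgn c * bucketSum (h i) (erase i (fval B₁)) h s
rowEst-resample B₁ {m} h s i c = begin
  sgn (s′ i) * Σ (λ j → if does (h j Fin.≟ h i) then sgn (s′ j) * fval B₁ j else 0ℚ)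
    ≡⟨ cong₂ _*_ (cong sgn (updateAt-updates i s)) (Σ-cong split) ⟩
  sgn c * Σ (λ j → noise j + signal j)             ≡⟨ cong (sgn c *_) (sumOver-+ (allFin m) noise signal) ⟩
  sgn c * (Σ noise + Σ signal)                     ≡⟨ cong (λ x → sgn c * (Σ noise + x)) (Σ-single i (sgn c * fval B₁ i)) ⟩
  sgn c * (Σ noise + sgn c * fval B₁ i)            ≡⟨ expand (sgn c) (Σ noise) (fval B₁ i) ⟩
  sgn c * sgn c * fval B₁ i + sgn c * Σ noise      ≡⟨ cong (λ x → x * fval B₁ i + sgn c * Σ noise) (sgn²≡1 c) ⟩
  1ℚ * fval B₁ i + sgn c * Σ noise                 ≡⟨ cong₂ _+_ (*-identityˡ (fval B₁ i)) (cong (sgn c *_) (sym (bucketSum≡ (h i) w h s))) ⟩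
  fval B₁ i + sgn c * bucketSum (h i) w h s        ∎
  where
  open ≡-Reasoning
  s′ = updateAt s i (const c)
  w = erase i (fval B₁)
  noise signal : Fin m → ℚ
  noise j = if does (h j Fin.≟ h i) then sgn (s j) * w j else 0ℚ
  signal j = if does (j Fin.≟ i) then sgn c * fval B₁ i else 0ℚ
  expand : ∀ σ n f → σ * (n + σ * f) ≡ σ * σ * f + σ * n
  expand = solve-∀ ℚ-ring
  at-i : ∀ σ x → x ≡ σ * 0ℚ + x
  at-i = solve-∀ ℚ-ring
  split : ∀ j → (if does (h j Fin.≟ h i) then sgn (s′ j) * fval B₁ j else 0ℚ) ≡ noise j + signal j
  split j with j Fin.≟ i
  ... | yes refl rewrite dec-true (h i Fin.≟ h i) refl = trans (cong (λ σ → sgn σ * fval B₁ i) (updateAt-updates i s)) (at-i (sgn (s i)) (sgn c * fval B₁ i))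
  ... | no  j≢i = trans (cong (λ σ → if does (h j Fin.≟ h i) then sgn σ * fval B₁ j else 0ℚ) (updateAt-minimal j i s j≢i))
                        (sym (+-identityʳ (if does (h j Fin.≟ h i) then sgn (s j) * fval B₁ j else 0ℚ)))

-- As `i` carries no weight, its hash only selects which bucket is inspected. This decouples the
-- bucket from the other hash values.
bucketSum-resample : ∀ {m b} (w : Fin m → ℚ) i → w i ≡ 0ℚ → ∀ (h : Fin m → Fin b) s a →
  bucketSum (updateAt h i (const a) i) w (updateAt h i (const a)) s ≡ bucketSum a w h s
bucketSum-resample {m} w i wi≡0 h s a = begin
  bucketSum (h′ i) w h′ s   ≡⟨ cong (λ β → bucketSum β w h′ s) (updateAt-updates i h) ⟩
  bucketSum a w h′ s        ≡⟨ bucketSum≡ a w h′ s ⟩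
  Σ (λ j → if does (h′ j Fin.≟ a) then sgn (s j) * w j else 0ℚ)  ≡⟨ Σ-cong same ⟩
  Σ (λ j → if does (h j Fin.≟ a) then sgn (s j) * w j else 0ℚ)   ≡⟨ bucketSum≡ a w h s ⟨
  bucketSum a w h s         ∎
  where
  open ≡-Reasoning
  h′ = updateAt h i (const a)
  vanish : ∀ c → (if c then sgn (s i) * w i else 0ℚ) ≡ 0ℚ
  vanish true  = trans (cong (sgn (s i) *_) wi≡0) (*-zeroʳ (sgn (s i)))
  vanish false = refl
  same : ∀ j → (if does (h′ j Fin.≟ a) then sgn (s j) * w j else 0ℚ) ≡ (if does (h j Fin.≟ a) then sgn (s j) * w j else 0ℚ)
  same j with j Fin.≟ i
  ... | yes refl = trans (vanish (does (h′ i Fin.≟ a))) (sym (vanish (does (h i Fin.≟ a))))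
  ... | no  j≢i  = cong (λ β → if does (β Fin.≟ a) then sgn (s j) * w j else 0ℚ) (updateAt-minimal j i h j≢i)

rowEst-cong : ∀ B₁ {m b} (h : Fin m → Fin b) i {s s′} → (∀ j → s j ≡ s′ j) → rowEst B₁ (h , s) i ≡ rowEst B₁ (h , s′) i
rowEst-cong B₁ h i eq = cong₂ _*_ (cong sgn (eq i))
  (Σ-cong λ j → cong (λ σ → if does (h j Fin.≟ h i) then sgn σ * fval B₁ j else 0ℚ) (eq j))

bucketSum-cong : ∀ {m b} (w : Fin m → ℚ) s i {h h′ : Fin m → Fin b} → (∀ j → h j ≡ h′ j) →
  bucketSum (h i) w h s ≡ bucketSum (h′ i) w h′ s
bucketSum-cong w s i {h} {h′} eq = trans (bucketSum≡ (h i) w h s) (trans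
  (Σ-cong λ j → cong₂ (λ β γ → if does (β Fin.≟ γ) then sgn (s j) * w j else 0ℚ) (eq j) (eq i))
  (sym (bucketSum≡ (h′ i) w h′ s)))

𝔼-complement : ∀ {A : Set} (xs : List A) → IsProb xs → ∀ X → 𝔼 xs (λ a → ½ * (1ℚ - X a)) ≡ ½ * (1ℚ - 𝔼 xs X)
𝔼-complement xs prob X = begin
  𝔼 xs (λ a → ½ * (1ℚ - X a))            ≡⟨ 𝔼-cong xs (λ a → expand (X a)) ⟩
  𝔼 xs (λ a → ½ + - ½ * X a)             ≡⟨ 𝔼-+ xs (λ _ → ½) (λ a → - ½ * X a) ⟩
  𝔼 xs (λ _ → ½) + 𝔼 xs (λ a → - ½ * X a)  ≡⟨ cong₂ _+_ (𝔼-const xs prob ½) (𝔼-* xs (- ½) X) ⟩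
  ½ + - ½ * 𝔼 xs X                       ≡⟨ expand (𝔼 xs X) ⟨
  ½ * (1ℚ - 𝔼 xs X)                      ∎
  where
  open ≡-Reasoning
  expand : ∀ x → ½ * (1ℚ - x) ≡ ½ + - ½ * x
  expand = solve-∀ ℚ-ring

-- Outside [-t, t) one of the two signs lifts the row to the threshold; inside, the left side is 0.
sign-average : ∀ f {t} → 0ℚ ≤ t → ∀ z →
  ½ * (1ℚ - cell (t + t) (- t) z) ≤ 𝔼 bools (λ c → indicator (reaches (f + t) (f + sgn c * z)))
sign-average f {t} 0≤t z = subst (½ * (1ℚ - C) ≤_) (sym (𝔼-bools (λ c → indicator (reaches (f + t) (f + sgn c * z)))))
  (*-monoˡ {½} 0≤½ sum)
  where
  C = cell (t + t) (- t) z
  up = indicator (reaches (f + t) (f + 1ℚ * z))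
  down = indicator (reaches (f + t) (f + - 1ℚ * z))
  0≤up : 0ℚ ≤ up
  0≤up = 0≤indicator (reaches (f + t) (f + 1ℚ * z))
  0≤down : 0ℚ ≤ down
  0≤down = 0≤indicator (reaches (f + t) (f + - 1ℚ * z))
  complement≤1 : 1ℚ - C ≤ 1ℚ
  complement≤1 = ≤-from-difference C (0≤cell (t + t) (- t) z) (cancel C)
    where
    cancel : ∀ x → 1ℚ ≡ 1ℚ - x + x
    cancel = solve-∀ ℚ-ring
  sum : 1ℚ - C ≤ up + down
  sum with t ≤? z
  ... | yes t≤z = ≤-trans complement≤1 (≤-from-difference down 0≤down (trans (+-comm up down) (trans (cong (down +_) up≡1) (+-comm down 1ℚ))))
    where
    up≡1 : up ≡ 1ℚ
    up≡1 = cong indicator (reaches-true (+-monoʳ-≤ f (subst (t ≤_) (sym (*-identityˡ z)) t≤z)))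
  ... | no t≰z with - t ≤? z
  ... | yes -t≤z = subst (_≤ up + down) (sym (cong (λ x → 1ℚ - x) inside)) (+-nonneg 0≤up 0≤down)
    where
    half : ∀ t → - t + (t + t) ≡ t
    half = solve-∀ ℚ-ring
    inside : C ≡ 1ℚ
    inside = cell-inside (t + t) (- t) z -t≤z (subst (z <_) (sym (half t)) (≰⇒> t≰z))
  ... | no -t≰z = ≤-trans complement≤1 (≤-from-difference up 0≤up (trans (cong (up +_) down≡1) (+-comm up 1ℚ)))
    where
    flip : ∀ z → - z ≡ - 1ℚ * z
    flip = solve-∀ ℚ-ring
    neg-neg : ∀ t → - (- t) ≡ t
    neg-neg = solve-∀ ℚ-ring
    down≡1 : down ≡ 1ℚ
    down≡1 = cong indicator (reaches-true (+-monoʳ-≤ f (subst₂ _≤_ (neg-neg t) (flip z) (neg-antimono-≤ (<⇒≤ (≰⇒> -t≰z))))))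

𝔼-≥ : ∀ {A : Set} (xs : List A) → IsProb xs → ∀ {X c} → (∀ a → c ≤ X a) → c ≤ 𝔼 xs X
𝔼-≥ xs prob {X} {c} ge = ≤-trans (≤-reflexive (sym (𝔼-const xs prob c))) (𝔼-mono xs ge)

-- The chain is best read from the bottom: resampling the sign at `i` produces the factor ½, and
-- resampling the hash at `i` turns the bucket into an independent outer variable, after which each
-- bucket can be treated separately.
row-probability : ∀ B₁ {m b} (i : Fin m) → Fin b → ∀ {t p} → 0ℚ ≤ t →
  survival (inv b) (countAbove t (erase i (fval B₁))) 1 ≤ p →
  ½ * (1ℚ - p) ≤ 𝔼 (allRows m b) (λ row → indicator (reaches (fval B₁ i + t) (rowEst B₁ row i)))
row-probability B₁ {m} {b} i β₀ {t} {p} 0≤t survival≤p = begin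
  ½ * (1ℚ - p)
    ≤⟨ 𝔼-≥ (allFin b) probᵇ per-bucket ⟩
  𝔼 (allFin b) (λ a → 𝔼 hs (λ h → 𝔼 ss (λ s → miss (bucketSum a w h s))))
    ≡⟨ 𝔼-swap hs (allFin b) (λ h a → 𝔼 ss (λ s → miss (bucketSum a w h s))) ⟨
  𝔼 hs (λ h → 𝔼 (allFin b) (λ a → 𝔼 ss (λ s → miss (bucketSum a w h s))))
    ≡⟨ 𝔼-cong hs (λ h → 𝔼-cong (allFin b) λ a → 𝔼-cong ss λ s → cong miss (bucketSum-resample w i (erase-self i (fval B₁)) h s a)) ⟨
  𝔼 hs (λ h → 𝔼 (allFin b) (λ a → 𝔼 ss (λ s → miss (bucketSum (updateAt h i (const a) i) w (updateAt h i (const a)) s))))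
    ≡⟨ 𝔼-resample m (allFin b) probᵇ i (λ h → 𝔼 ss (λ s → miss (bucketSum (h i) w h s)))
         (λ {h} {h′} eq → 𝔼-cong ss λ s → cong miss (bucketSum-cong w s i eq)) ⟨
  𝔼 hs (λ h → 𝔼 ss (λ s → miss (bucketSum (h i) w h s)))
    ≤⟨ 𝔼-mono hs (λ h → 𝔼-mono ss λ s → sign-average f 0≤t (bucketSum (h i) w h s)) ⟩
  𝔼 hs (λ h → 𝔼 ss (λ s → 𝔼 bools (λ c → hit (f + sgn c * bucketSum (h i) w h s))))
    ≡⟨ 𝔼-cong hs (λ h → 𝔼-cong ss λ s → 𝔼-cong bools λ c → cong hit (rowEst-resample B₁ h s i c)) ⟨
  𝔼 hs (λ h → 𝔼 ss (λ s → 𝔼 bools (λ c → hit (rowEst B₁ (h , updateAt s i (const c)) i))))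
    ≡⟨ 𝔼-cong hs (λ h → 𝔼-resample m bools IsProb-bools i (λ s → hit (rowEst B₁ (h , s) i)) (λ eq → cong hit (rowEst-cong B₁ h i eq))) ⟨
  𝔼 hs (λ h → 𝔼 ss (λ s → hit (rowEst B₁ (h , s) i)))
    ≡⟨ 𝔼-product hs ss (λ row → hit (rowEst B₁ row i)) ⟨
  𝔼 (allRows m b) (λ row → hit (rowEst B₁ row i)) ∎
  where
  open ≤-Reasoning
  hs = allFuns m (allFin b)
  ss = allFuns m bools
  f = fval B₁ i
  w = erase i (fval B₁)
  probᵇ = IsProb-allFin β₀
  hit miss : ℚ → ℚ
  hit x = indicator (reaches (f + t) x)
  miss z = ½ * (1ℚ - cell (t + t) (- t) z)
  one-cell : ∀ z → cells (t + t) (- t ∷ []) (0ℚ + z) ≡ cell (t + t) (- t) z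
  one-cell z = trans (cong (cells (t + t) (- t ∷ [])) (+-identityˡ z)) (trans (cells-∷ (t + t) (- t) [] z)
    (trans (cong (cell (t + t) (- t) z +_) (cells-[] (t + t) z)) (+-identityʳ (cell (t + t) (- t) z))))
  per-bucket : ∀ a → ½ * (1ℚ - p) ≤ 𝔼 hs (λ h → 𝔼 ss (λ s → miss (bucketSum a w h s)))
  per-bucket a = begin
    ½ * (1ℚ - p)
      -- The family consists of the one cell [-t, t), which is why the walk starts at 1.
      ≤⟨ *-monoˡ {½} 0≤½ (+-monoʳ-≤ 1ℚ (neg-antimono-≤ (≤-trans (LittlewoodOfford.concentration a t 0≤t m w 0ℚ {xs = - t ∷ []} [-]) survival≤p))) ⟩
    ½ * (1ℚ - 𝔼 hs (λ h → 𝔼 ss (λ s → cells (t + t) (- t ∷ []) (0ℚ + bucketSum a w h s))))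
      ≡⟨ 𝔼-complement hs (IsProb-allFuns m (allFin b) probᵇ) (λ h → 𝔼 ss (λ s → cells (t + t) (- t ∷ []) (0ℚ + bucketSum a w h s))) ⟨
    𝔼 hs (λ h → ½ * (1ℚ - 𝔼 ss (λ s → cells (t + t) (- t ∷ []) (0ℚ + bucketSum a w h s))))
      ≡⟨ 𝔼-cong hs (λ h → 𝔼-complement ss (IsProb-allFuns m bools IsProb-bools) (λ s → cells (t + t) (- t ∷ []) (0ℚ + bucketSum a w h s))) ⟨
    𝔼 hs (λ h → 𝔼 ss (λ s → ½ * (1ℚ - cells (t + t) (- t ∷ []) (0ℚ + bucketSum a w h s))))
      ≡⟨ 𝔼-cong hs (λ h → 𝔼-cong ss λ s → cong (λ x → ½ * (1ℚ - x)) (one-cell (bucketSum a w h s))) ⟩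
    𝔼 hs (λ h → 𝔼 ss (λ s → miss (bucketSum a w h s))) ∎

-- Choice of parameters and assembly

countAbove-initial : ∀ {t} B {m} (w : Fin m → ℚ) → B ℕ.≤ m → (∀ j → toℕ j ℕ.< B → t ≤ w j) → B ℕ.≤ countAbove t w
countAbove-initial zero    w B≤m large = z≤n
countAbove-initial (suc B) {suc m} w (s≤s B≤m) large rewrite reaches-true (large zero (s≤s z≤n)) =
  s≤s (countAbove-initial B (w ∘ suc) B≤m (λ j j<B → large (suc j) (s≤s j<B)))

-- The index `i` may itself be among the first `B`, which costs at most one step. The `suc` is
-- absorbed by the factor N + 1 in `survival-bound`.
countAbove-initial-except : ∀ {t} B {m} (w : Fin m → ℚ) i → B ℕ.≤ m → (∀ j → j ≢ i → toℕ j ℕ.< B → t ≤ w j) →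
  B ℕ.≤ suc (countAbove t w)
countAbove-initial-except zero    w i B≤m large = z≤n
countAbove-initial-except {t} (suc B) {suc m} w zero (s≤s B≤m) large =
  s≤s (ℕ.≤-trans (countAbove-initial B (w ∘ suc) B≤m (λ j j<B → large (suc j) (λ ()) (s≤s j<B))) (grow (reaches t (w zero))))
  where
  grow : ∀ c {n} → n ℕ.≤ (if c then suc else id) n
  grow true  = ℕ.n≤1+n _
  grow false = ℕ.≤-refl
countAbove-initial-except (suc B) {suc m} w (suc i) (s≤s B≤m) large rewrite reaches-true (large zero (λ ()) (s≤s z≤n)) =
  s≤s (countAbove-initial-except B (w ∘ suc) i B≤m (λ j j≢i j<B → large (suc j) (j≢i ∘ Fin.suc-injective) (s≤s j<B)))

-- That is, (e + 1)² ≤ k + 1 < (e + 2)².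
square-root : ∀ {k} → 3 ℕ.≤ k →
  Σ[ e ∈ ℕ ] 1 ℕ.≤ e × e ℕ.* suc (suc e) ℕ.≤ k × k ℕ.< suc e ℕ.* suc (suc (suc e))
square-root 3≤k = go (ℕ.≤⇒≤′ 3≤k)
  where
  expand : ∀ e → suc (suc e ℕ.* suc (suc (suc e))) ℕ.+ suc (suc (suc (suc (e ℕ.+ e)))) ≡ suc (suc e) ℕ.* suc (suc (suc (suc e)))
  expand = ℕ-solve-∀
  go : ∀ {k} → 3 ℕ.≤′ k → Σ[ e ∈ ℕ ] 1 ℕ.≤ e × e ℕ.* suc (suc e) ℕ.≤ k × k ℕ.< suc e ℕ.* suc (suc (suc e))
  go ℕ.≤′-refl = 1 , ℕ.≤-refl , ℕ.≤-refl , ℕ.≤ᵇ⇒≤ 4 8 _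
  go (ℕ.≤′-step {k} 3≤′k) with go 3≤′k
  ... | e , 1≤e , lower , upper with suc k ℕ.<? suc e ℕ.* suc (suc (suc e))
  ... | yes upper′ = e , 1≤e , ℕ.m≤n⇒m≤1+n lower , upper′
  ... | no  ≮      = suc e , s≤s z≤n , ℕ.≮⇒≥ ≮ ,
    ℕ.<-≤-trans (s≤s upper) (ℕ.≤-trans (ℕ.m≤m+n (suc (suc e ℕ.* suc (suc (suc e)))) (suc (suc (suc (suc (e ℕ.+ e)))))) (ℕ.≤-reflexive (expand e)))

-- The outer ½ is B₂t, `½⁵⁴` bounds (1 - p²)^k from below, and ½ * ½ is the square of the fair-coin
-- tail at the median.
errorConstant : ℚ
errorConstant = ½ * (½⁵⁴ * (½ * ½))

0<errorConstant : 0ℚ < errorConstant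
0<errorConstant = positive⁻¹ errorConstant {{pos*pos⇒pos ½ (½⁵⁴ * (½ * ½)) {{pos*pos⇒pos ½⁵⁴ {{positive 0<½⁵⁴}} (½ * ½)}}}}

error-bound : ∀ n B₁ B₂ k b → 1 ℕ.≤ B₁ → B₁ ℕ.+ B₁ ℕ.≤ B₁ ℕ.+ B₂ → B₁ ℕ.+ B₂ ℕ.≤ n →
  3 ℕ.≤ k → k ℕ.% 2 ≡ 1 → B₂ ≡ k ℕ.* b → (i : Fin (n ℕ.∸ B₁)) →
  errorConstant ≤ ι B₂ * 𝔼 (allOutcomes k (n ℕ.∸ B₁) b) (λ ω → ∣ ftilde B₁ ω i - fval B₁ i ∣)
-- The hypotheses force B₂ and then b to be positive, so that t and 1/b are genuine reciprocals.
error-bound n B₁ zero k b 1≤B₁ 2B₁≤ _ _ _ _ i = contradiction (ℕ.≤-trans 1≤B₁ (ℕ.+-cancelˡ-≤ B₁ B₁ 0 2B₁≤)) λ ()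
error-bound n B₁ B₂@(suc _) k zero _ _ _ _ _ B₂≡kb i = contradiction (trans B₂≡kb (ℕ.*-zeroʳ k)) λ ()
error-bound n B₁ B₂@(suc B₂-1) k b@(suc b-1) 1≤B₁ 2B₁≤ B₁+B₂≤n 3≤k k%2≡1 B₂≡kb i
  with square-root 3≤k
... | e , 1≤e , lower , upper = begin
  ½ * (½⁵⁴ * (½ * ½))
    ≤⟨ *-monoˡ {½} 0≤½ (*-monoʳ {½ * ½} (≤ᵇ⇒≤ _) (power-bound 1≤e k≤2L²)) ⟩
  ½ * ((1ℚ - p * p) ^ k * (½ * ½))
    ≡⟨ cong₂ (λ x y → ½ * (x ^ k * (y * y))) (bias p) (sym (binTail-median {k} {r} r+r≡1+k)) ⟩
  ½ * (((q + q) * ((1ℚ - q) + (1ℚ - q))) ^ k * (binTail ½ k r * binTail ½ k r))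
    ≤⟨ *-monoˡ {½} 0≤½ (binTail-tilt 0≤q q≤1 k r) ⟩
  ½ * binTail q k r
    ≤⟨ *-monoˡ {½} 0≤½ (binTail≤𝔼 prob hit (row-probability B₁ i zero 0≤t survival≤p) 0≤q q≤1 k r) ⟩
  ½ * 𝔼 Ω (λ ω → indicator (atLeast r (hit ∘ ω)))
    ≡⟨ cong (_* 𝔼 Ω (λ ω → indicator (atLeast r (hit ∘ ω)))) B₂t≡½ ⟨
  ι B₂ * t * 𝔼 Ω (λ ω → indicator (atLeast r (hit ∘ ω)))
    ≡⟨ trans (*-assoc (ι B₂) t (𝔼 Ω (λ ω → indicator (atLeast r (hit ∘ ω))))) (cong (ι B₂ *_) (sym (𝔼-* Ω t (λ ω → indicator (atLeast r (hit ∘ ω)))))) ⟩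
  ι B₂ * 𝔼 Ω (λ ω → t * indicator (atLeast r (hit ∘ ω)))
    ≤⟨ *-monoˡ {ι B₂} (0≤ι B₂) (𝔼-mono Ω (λ ω → median-error B₁ ω i 0≤t k-odd)) ⟩
  ι B₂ * 𝔼 Ω (λ ω → ∣ ftilde B₁ ω i - fval B₁ i ∣) ∎
  where
  open ≤-Reasoning
  m = n ℕ.∸ B₁
  Ω = allOutcomes k m b
  r = suc (k ℕ./ 2)
  t = inv (B₂ ℕ.+ B₂)
  p = p₀ e
  q = ½ * (1ℚ - p)
  hit : Row m b → Bool
  hit row = reaches (fval B₁ i + t) (rowEst B₁ row i)

  0≤t : 0ℚ ≤ t
  0≤t = 0≤inv (B₂ ℕ.+ B₂)

  prob : IsProb (allRows m b)
  prob = IsProb-product (allFuns m (allFin b)) (allFuns m bools)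
    (IsProb-allFuns m (allFin b) (IsProb-allFin {b} zero)) (IsProb-allFuns m bools IsProb-bools)

  k-odd : k ≡ 1 ℕ.+ k ℕ./ 2 ℕ.* 2
  k-odd = trans (ℕ.m≡m%n+[m/n]*n k 2) (cong (ℕ._+ k ℕ./ 2 ℕ.* 2) k%2≡1)

  r+r≡1+k : r ℕ.+ r ≡ suc k
  r+r≡1+k = trans (double (k ℕ./ 2)) (cong suc (sym k-odd))
    where
    double : ∀ h → suc h ℕ.+ suc h ≡ suc (1 ℕ.+ h ℕ.* 2)
    double = ℕ-solve-∀

  -- From k < (e + 1)(e + 3) follows k ≤ e² + 4e + 2, and 2(e + 1)² exceeds this by e².
  k≤2L² : k ℕ.≤ 2 ℕ.* (suc e ℕ.* suc e)
  k≤2L² = ℕ.≤-trans (ℕ.s≤s⁻¹ upper) (ℕ.≤-trans (ℕ.m≤m+n (suc (suc e) ℕ.+ e ℕ.* suc (suc (suc e))) (e ℕ.* e)) (ℕ.≤-reflexive (expand e)))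
    where
    expand : ∀ e → suc (suc e) ℕ.+ e ℕ.* suc (suc (suc e)) ℕ.+ e ℕ.* e ≡ 2 ℕ.* (suc e ℕ.* suc e)
    expand = ℕ-solve-∀

  B₁≤B₂ : B₁ ℕ.≤ B₂
  B₁≤B₂ = ℕ.+-cancelˡ-≤ B₁ B₁ B₂ 2B₁≤

  -- Such an index stands for an element B₁ + 1 + `toℕ j` ≤ B₁ + B₂ ≤ 2B₂ of the domain; this
  -- explains the 2 in t = 1/(2B₂).
  large : ∀ j → j ≢ i → toℕ j ℕ.< B₂ → t ≤ erase i (fval B₁) j
  large j j≢i j<B₂ = subst (t ≤_) (sym (erase-other (fval B₁) j≢i))
    (inv-antitone (ℕ.≤-trans (ℕ.+-mono-≤ B₁≤B₂ (ℕ.s≤s⁻¹ j<B₂)) (ℕ.≤-reflexive (sym (ℕ.+-suc B₂-1 B₂-1)))))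

  B₂≤m : B₂ ℕ.≤ m
  B₂≤m = ℕ.m+n≤o⇒m≤o∸n B₂ (subst (ℕ._≤ n) (ℕ.+-comm B₁ B₂) B₁+B₂≤n)

  survival≤p : survival (inv b) (countAbove t (erase i (fval B₁))) 1 ≤ p
  survival≤p = survival-at-1 b-1 e k (countAbove t (erase i (fval B₁))) lower
    (subst (ℕ._≤ suc (countAbove t (erase i (fval B₁)))) B₂≡kb (countAbove-initial-except B₂ (erase i (fval B₁)) i B₂≤m large))

  0≤q : 0ℚ ≤ q
  0≤q = *-nonneg 0≤½ (0≤q-p (p₀≤1 1≤e))

  q≤1 : q ≤ 1ℚ
  q≤1 = ≤-from-difference (½ * (1ℚ + p)) (*-nonneg 0≤½ (+-nonneg {1ℚ} {p} 0≤1 (0≤p₀ 1≤e))) (complement p)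
    where
    complement : ∀ p → 1ℚ ≡ ½ * (1ℚ - p) + ½ * (1ℚ + p)
    complement = solve-∀ ℚ-ring

  bias : ∀ p → 1ℚ - p * p ≡ (½ * (1ℚ - p) + ½ * (1ℚ - p)) * ((1ℚ - ½ * (1ℚ - p)) + (1ℚ - ½ * (1ℚ - p)))
  bias = solve-∀ ℚ-ring

  B₂t≡½ : ι B₂ * t ≡ ½
  B₂t≡½ = trans (halve (ι B₂) t) (cong (½ *_) (trans (cong (_* t) (sym (ι-+ B₂ B₂))) (ι*inv (B₂-1 ℕ.+ B₂))))
    where
    halve : ∀ x t → x * t ≡ ½ * ((x + x) * t)
    halve = solve-∀ ℚ-ring

theorem16 : Σ[ c ∈ ℚ ] ((0ℚ ℚ.< c) ×
    ((n B₁ B₂ k b : ℕ) → 1 ℕ.≤ B₁ → B₁ ℕ.+ B₁ ℕ.≤ B₁ ℕ.+ B₂ → B₁ ℕ.+ B₂ ℕ.≤ n →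
    3 ℕ.≤ k → k ℕ.% 2 ≡ 1 → B₂ ≡ k ℕ.* b →
    (i : Fin (n ℕ.∸ B₁)) →
    c ℚ.≤ (ℤ.+ B₂ ℚ./ 1) ℚ.* expErr n B₁ k b i))
theorem16 = errorConstant , 0<errorConstant , λ n B₁ B₂ k b 1≤B₁ 2B₁≤ B₁+B₂≤n 3≤k odd B₂≡kb i →
  subst₂ (λ x y → errorConstant ≤ x * y) (ι≡ B₂) (𝔼≡avg (allOutcomes k (n ℕ.∸ B₁) b) (λ ω → ∣ ftilde B₁ ω i - fval B₁ i ∣))
    (error-bound n B₁ B₂ k b 1≤B₁ 2B₁≤ B₁+B₂≤n 3≤k odd B₂≡kb i)
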